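{- Let $n\ge 2$, let $K_n=(V,E)$ be the complete graph on the vertex set $V$ with $|V|=n$, and let $X,Y$ be two distinct cuts of $K_n$. Then the cones $K^{+}_{\max}(X)$ and $K^{+}_{\max}(Y)$ are adjacent (i.e. $\dim\big(K^{+}_{\max}(X)\cap K^{+}_{\max}(Y)\big)=d-1$, where $d=\binom{n}{2}$) if and only if one of the following holds: (i) $X$ and $Y$ are crossing; or (ii) $|X\ominus Y|=1$, or $|\bar X\ominus Y|=1$, or $|X\ominus\bar Y|=1$, or $|\bar X\ominus\bar Y|=1$, where $\ominus$ denotes symmetric difference and $\bar X=V\setminus X$.
   Context: Let $d=\binom{n}{2}=|E|$. For $S\subseteq V$, the cut vector $\mathbf{v}(S)\in\{0,1\}^{d}$ has coordinates indexed by edges $\{i,j\}\in E$, with $\mathbf{v}(S)_{i,j}=1$ if $|S\cap\{i,j\}|=1$ and $0$ otherwise. A cut is a nonempty proper subset $X\subset V$, where $X$ and its complement $\bar X=V\setminus X$ are identified (they have the same cut vector); the empty cut is excluded, so there are $2^{n-1}-1$ cuts. For a cut $X$, define the convex polyhedral cone $K^{+}_{\max}(X)=\{\mathbf{c}\in\mathbb{R}^{d}:\ \mathbf{c}\ge\mathbf{0},\ \langle\mathbf{c},\mathbf{v}(X)\rangle\ge\langle\mathbf{c},\mathbf{v}(Y)\rangle \text{ for all cuts } Y\}$. These cones form the cone partition of the nonnegative orthant for the max-cut problem with non-negative edge weights. Two such cones $K^{+}_{\max}(X),K^{+}_{\max}(Y)$ ($X\ne Y$) are called adjacent if $\dim\big(K^{+}_{\max}(X)\cap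 K^{+}_{\max}(Y)\big)=d-1$. Two subsets $A,B\subset V$ are crossing if $A\cap B\neq\emptyset$, $A\setminus B\ne\emptyset$, $B\setminus A\neq\emptyset$ and $V\setminus(A\cup B)\neq\emptyset$.
   Formalization: The cones are taken in the space of rational edge weights instead of real ones, and their dimension is the maximal number of vectors in them that are linearly independent over the rationals. -}

module Defs where

open import Data.Nat using (ℕ; suc)
open import Data.Bool using (Bool; true; false; if_then_else_; _xor_)
open import Data.Fin using (Fin; _<_; _<?_)
open import Data.Fin.Subset using (Subset; ∁; _∩_; _∪_; _─_; ∣_∣; Nonempty)
open import Data.Vec using (lookup)
open import Data.List using (List; []; _∷_; concatMap; map; foldr; allFin)
open import Data.Rational using (ℚ; 0ℚ; 1ℚ; _+_; _*_; _≤_)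
open import Data.Product using (_×_; ∃; Σ)
open import Relation.Nullary using (¬_; yes; no)
open import Relation.Binary.PropositionalEquality using (_≡_; _≢_)

record Edge (n : ℕ) : Set where
  constructor edge
  field
    i   : Fin n
    j   : Fin n
    i<j : i < j

edges : (n : ℕ) → List (Edge n)
edges n = concatMap (λ a → concatMap (λ b → pick a b) (allFin n)) (allFin n)
  where
  pick : Fin n → Fin n → List (Edge n)
  pick a b with a <? b
  ... | yes p = edge a b p ∷ []
  ... | no _  = []

Vector : ℕ → Set
Vector n = Edge n → ℚ

sumE : {n : ℕ} → (Edge n → ℚ) → ℚ
sumE {n} f = foldr _+_ 0ℚ (map f (edges n))

⟨_,_⟩ : {n : ℕ} → Vector n → Vector n → ℚ
⟨ c , w ⟩ = sumE (λ e → c e * w e)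

cutVec : {n : ℕ} → Subset n → Vector n
cutVec S (edge i j _) = if lookup S i xor lookup S j then 1ℚ else 0ℚ

IsCut : {n : ℕ} → Subset n → Set
IsCut X = Nonempty X × Nonempty (∁ X)

DistinctCuts : {n : ℕ} → Subset n → Subset n → Set
DistinctCuts X Y = X ≢ Y × X ≢ ∁ Y

KmaxPlus : {n : ℕ} → Subset n → Vector n → Set
KmaxPlus {n} X c = (∀ e → 0ℚ ≤ c e) × (∀ (Y : Subset n) → IsCut Y → ⟨ c , cutVec Y ⟩ ≤ ⟨ c , cutVec X ⟩)

LinIndep : {n k : ℕ} → (Fin k → Vector n) → Set
LinIndep {n} {k} u =
  ∀ (a : Fin k → ℚ) → (∀ (e : Edge n) → foldr _+_ 0ℚ (map (λ t → a t * u t e) (allFin k)) ≡ 0ℚ) → ∀ t → a t ≡ 0ℚ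

-- dim C = m : C contains m linearly independent vectors and no m+1
-- (dimension of the linear span, = dim of affine hull for a cone)
HasDim : {n : ℕ} → (Vector n → Set) → ℕ → Set
HasDim {n} C m =
  (Σ (Fin m → Vector n) λ u → (∀ t → C (u t)) × LinIndep u)
  × (∀ (u : Fin (suc m) → Vector n) → (∀ t → C (u t)) → ¬ LinIndep u)

Crossing : {n : ℕ} → Subset n → Subset n → Set
Crossing A B = Nonempty (A ∩ B) × Nonempty (A ─ B) × Nonempty (B ─ A) × Nonempty (∁ (A ∪ B))

_⊖_ : {n : ℕ} → Subset n → Subset n → Subset n
A ⊖ B = (A ─ B) ∪ (B ─ A)

Adjacent : {n : ℕ} → Subset n → Subset n → Set
Adjacent {n} X Y = HasDim (λ c → KmaxPlus X c × KmaxPlus Y c) (n C 2 ∸ 1)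
  where open import Data.Nat using (_∸_)
        open import Data.Nat.Combinatorics using (_C_)

{-# OPTIONS --safe #-}
module Submission where

open import Defs
open import Data.Bool using (Bool; true; false; not; if_then_else_; _xor_; _∧_; _∨_)
import Data.Bool.Properties as Bool
open import Data.Fin using (Fin; zero; suc; _<?_)
import Data.Fin as Fin
import Data.Fin.Properties as Fin
open import Data.Fin.Subset using (Subset; ∁; ∣_∣; _∩_; _∪_; _─_; Nonempty)
open import Data.Fin.Subset.Properties using (∪-comm)
open import Data.List using (List; []; _∷_; _++_; [_]; map; foldr; allFin; tabulate; length; concatMap)
import Data.List as List
open import Data.List.Membership.Propositional using (_∈_; _∉_; find; lose)
open import Data.List.Membership.Propositional.Properties using (∈-∃++; ∈-++⁺ˡ; ∈-++⁺ʳ; ∈-++⁻; ∈-lookup; ∈-allFin; ∈-concatMap⁺; ∈-concatMap⁻)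
open import Data.List.Properties using (map-cong; map-tabulate; length-++)
open import Data.List.Relation.Unary.All using (All; []; _∷_)
import Data.List.Relation.Unary.All as All
open import Data.List.Relation.Unary.AllPairs using ([]; _∷_)
open import Data.List.Relation.Unary.Any using (here; there; any?; satisfied)
open import Data.List.Relation.Unary.Unique.Propositional using (Unique)
open import Data.List.Relation.Unary.Unique.Propositional.Properties using (allFin⁺; ++⁺)
open import Data.Nat as ℕ using (ℕ; zero; suc; s≤s)
open import Data.Nat.Combinatorics using (_C_; nC1≡n; nCk+nC[k+1]≡[n+1]C[k+1])
import Data.Nat.Properties as ℕ
open import Data.Product using (_×_; _,_; ∃; ∃₂; Σ; proj₁; proj₂; swap)
open import Data.Rational hiding (truncate; ∣_∣; _<?_)
open import Data.Rational.Properties hiding (_<?_)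
open import Data.Rational.Solver using (module +-*-Solver)
open import Data.Sum using (_⊎_; inj₁; inj₂)
open import Data.Vec using ([]; _∷_; lookup; _[_]≔_)
open import Data.Vec.Properties using ([]=⇒lookup; lookup⇒[]=; lookup-map; lookup-zipWith; lookup∘update; lookup∘update′)
open import Function using (_∘_)
open import Function.Bundles using (_⇔_; mk⇔)
open import Relation.Binary using (tri<; tri≈; tri>)
open import Relation.Binary.PropositionalEquality hiding ([_])
open import Relation.Nullary using (¬_; Dec; yes; no; contradiction; does)
open import Relation.Nullary.Decidable using (isYes; isYes≗does; dec-true; dec-false; from-yes; _×-dec_; ¬?; decidable-stable)
open +-*-Solver using (solve; _:=_; _:+_; _:*_; :-_; _:-_)

-- Let L(c) = ⟨c, v(X)⟩ - ⟨c, v(Y)⟩, which vanishes on K(X) ∩ K(Y); so the dimension is at most d - 1.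
--
-- Sufficiency. Call an edge strong if both X and Y cut it.  In cases (i) and (ii) a set Z cutting every strong
-- edge has the cut vector of X or of Y.  Fix edges e⁺, cut by X only, and e⁻, cut by Y only.  For each e ≠ e⁻ take
-- twice the indicator of the strong edges plus a perturbation in ker L of total weight at most 2: the indicator of e,
-- completed by e⁻ (if L(e) = 1) or by e⁺ (if L(e) = -1).  Any other Z misses a strong edge and loses 2, hence these
-- d - 1 vectors lie in both cones; they are linearly independent.
--
-- Necessity. If X and Y do not cross, then up to complements X ⊆ Y.  If p ≠ q lie in Y ─ X, uncrossing
-- with the cuts X ∪ {p} and Y ─ {p} forces c(pq) = 0 on K(X) ∩ K(Y), a second equation besides L = 0.

-- Finite sums of rationals over lists.

∑ : {A : Set} → List A → (A → ℚ) → ℚ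
∑ xs f = foldr _+_ 0ℚ (map f xs)

module _ {A : Set} where

  ∑-cong : ∀ (xs : List A) {f g : A → ℚ} → (∀ x → f x ≡ g x) → ∑ xs f ≡ ∑ xs g
  ∑-cong xs f≗g = cong (foldr _+_ 0ℚ) (map-cong f≗g xs)

  ∑-zero : ∀ (xs : List A) {f : A → ℚ} → All (λ x → f x ≡ 0ℚ) xs → ∑ xs f ≡ 0ℚ
  ∑-zero []       []         = refl
  ∑-zero (x ∷ xs) (fx ∷ fxs) = cong₂ _+_ fx (∑-zero xs fxs)

  ∑-distrib-+ : ∀ (xs : List A) (f g : A → ℚ) → ∑ xs (λ x → f x + g x) ≡ ∑ xs f + ∑ xs g
  ∑-distrib-+ []       f g = refl
  ∑-distrib-+ (x ∷ xs) f g = trans (cong (f x + g x +_) (∑-distrib-+ xs f g))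
    (solve 4 (λ a b c d → a :+ b :+ (c :+ d) := a :+ c :+ (b :+ d)) refl (f x) (g x) (∑ xs f) (∑ xs g))

  ∑-distrib-minus : ∀ (xs : List A) (f g : A → ℚ) → ∑ xs (λ x → f x - g x) ≡ ∑ xs f - ∑ xs g
  ∑-distrib-minus []       f g = refl
  ∑-distrib-minus (x ∷ xs) f g = trans (cong (f x - g x +_) (∑-distrib-minus xs f g))
    (solve 4 (λ a b c d → a :- b :+ (c :- d) := a :+ c :- (b :+ d)) refl (f x) (g x) (∑ xs f) (∑ xs g))

  *-distribˡ-∑ : ∀ (xs : List A) c (f : A → ℚ) → c * ∑ xs f ≡ ∑ xs (λ x → c * f x)
  *-distribˡ-∑ []       c f = *-zeroʳ c
  *-distribˡ-∑ (x ∷ xs) c f = trans (*-distribˡ-+ c (f x) (∑ xs f)) (cong (c * f x +_) (*-distribˡ-∑ xs c f))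

  ∑-mono-≤ : ∀ (xs : List A) {f g : A → ℚ} → (∀ x → f x ≤ g x) → ∑ xs f ≤ ∑ xs g
  ∑-mono-≤ []       f≤g = ≤-refl
  ∑-mono-≤ (x ∷ xs) f≤g = +-mono-≤ (f≤g x) (∑-mono-≤ xs f≤g)

  ∑-nonNeg : ∀ (xs : List A) {f : A → ℚ} → (∀ x → 0ℚ ≤ f x) → 0ℚ ≤ ∑ xs f
  ∑-nonNeg []       0≤f = ≤-refl
  ∑-nonNeg (x ∷ xs) 0≤f = +-mono-≤ (0≤f x) (∑-nonNeg xs 0≤f)

  term≤∑ : ∀ {xs : List A} {f : A → ℚ} → (∀ x → 0ℚ ≤ f x) → ∀ {x} → x ∈ xs → f x ≤ ∑ xs f
  term≤∑ {y ∷ xs} {f} 0≤f (here refl) = subst (_≤ f y + ∑ xs f) (+-identityʳ (f y)) (+-monoʳ-≤ (f y) (∑-nonNeg xs 0≤f))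
  term≤∑ {y ∷ xs} {f} 0≤f {x} (there x∈xs) = subst (_≤ f y + ∑ xs f) (+-identityˡ (f x)) (+-mono-≤ (0≤f y) (term≤∑ 0≤f x∈xs))

  ∑-single : ∀ {xs : List A} {f : A → ℚ} → Unique xs → ∀ {x} → x ∈ xs →
             (∀ y → y ≢ x → f y ≡ 0ℚ) → ∑ xs f ≡ f x
  ∑-single {y ∷ xs} {f} (y∉xs ∷ _) (here refl) f≡0 =
    trans (cong (f y +_) (∑-zero xs (All.map (λ y≢z → f≡0 _ (y≢z ∘ sym)) y∉xs))) (+-identityʳ (f y))
  ∑-single {y ∷ xs} {f} (y∉xs ∷ uniq) {x} (there x∈xs) f≡0 =
    trans (cong₂ _+_ (f≡0 y (All.lookup y∉xs x∈xs)) (∑-single uniq x∈xs f≡0)) (+-identityˡ (f x))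

∑-swap : ∀ {A B : Set} (xs : List A) (ys : List B) (f : A → B → ℚ) →
         ∑ xs (λ x → ∑ ys (f x)) ≡ ∑ ys (λ y → ∑ xs (λ x → f x y))
∑-swap []       ys f = sym (∑-zero ys (All.universal (λ _ → refl) ys))
∑-swap (x ∷ xs) ys f = trans (cong (∑ ys (f x) +_) (∑-swap xs ys f))
  (sym (∑-distrib-+ ys (f x) (λ y → ∑ xs (λ x → f x y))))

∑-allFin-suc : ∀ {k} (f : Fin (suc k) → ℚ) → ∑ (allFin (suc k)) f ≡ f zero + ∑ (allFin k) (f ∘ suc)
∑-allFin-suc {k} f = cong (λ ys → f zero + foldr _+_ 0ℚ ys)
  (trans (map-tabulate suc f) (sym (map-tabulate (λ t → t) (f ∘ suc))))

-- Cancellation, signs of products and squares in the rationals.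

*-cancelˡ-≡0 : ∀ {p q} → p ≢ 0ℚ → p * q ≡ 0ℚ → q ≡ 0ℚ
*-cancelˡ-≡0 {p} {q} p≢0 pq≡0 = begin
  q               ≡⟨ *-identityˡ q ⟨
  1ℚ * q          ≡⟨ cong (_* q) (*-inverseˡ p) ⟨
  (1/ p) * p * q  ≡⟨ *-assoc (1/ p) p q ⟩
  1/ p * (p * q)  ≡⟨ cong (1/ p *_) pq≡0 ⟩
  1/ p * 0ℚ       ≡⟨ *-zeroʳ (1/ p) ⟩
  0ℚ              ∎
  where
  open ≡-Reasoning
  instance nz = ≢-nonZero p≢0

*-nonNeg : ∀ {p q} → 0ℚ ≤ p → 0ℚ ≤ q → 0ℚ ≤ p * q
*-nonNeg {p} {q} 0≤p 0≤q = nonNegative⁻¹ (p * q) {{nonNeg*nonNeg⇒nonNeg p {{nonNegative 0≤p}} q {{nonNegative 0≤q}}}}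

square≥0 : ∀ p → 0ℚ ≤ p * p
square≥0 p with ≤-total 0ℚ p
... | inj₁ 0≤p = *-nonNeg 0≤p 0≤p
... | inj₂ p≤0 = subst (0ℚ ≤_) (solve 1 (λ x → (:- x) :* (:- x) := x :* x) refl p)
                   (*-nonNeg (neg-antimono-≤ p≤0) (neg-antimono-≤ p≤0))

square≡0 : ∀ {p} → p * p ≡ 0ℚ → p ≡ 0ℚ
square≡0 {p} pp≡0 with p ≟ 0ℚ
... | yes p≡0 = p≡0
... | no  p≢0 = *-cancelˡ-≡0 p≢0 pp≡0

-- Removing an entry from a list; linear dependence over the rationals.

length-remove : ∀ {A : Set} (ys : List A) {x zs} → length (ys ++ [ x ] ++ zs) ≡ suc (length (ys ++ zs))
length-remove ys {x} {zs} = begin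
  length (ys ++ x ∷ zs)            ≡⟨ length-++ ys ⟩
  length ys ℕ.+ suc (length zs)    ≡⟨ ℕ.+-suc (length ys) (length zs) ⟩
  suc (length ys ℕ.+ length zs)    ≡⟨ cong suc (length-++ ys) ⟨
  suc (length (ys ++ zs))          ∎
  where open ≡-Reasoning

∈-remove : ∀ {A : Set} (ys : List A) {x y zs} → y ∈ ys ++ [ x ] ++ zs → y ≡ x ⊎ y ∈ ys ++ zs
∈-remove ys y∈ with ∈-++⁻ ys y∈
... | inj₁ y∈ys         = inj₂ (∈-++⁺ˡ y∈ys)
... | inj₂ (here y≡x)   = inj₁ y≡x
... | inj₂ (there y∈zs) = inj₂ (∈-++⁺ʳ ys y∈zs)

unitVec : ∀ {k} → Fin (suc k) → ℚ
unitVec zero    = 1ℚ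
unitVec (suc _) = 0ℚ

∑-unitVec : ∀ {k} (f : Fin (suc k) → ℚ) → ∑ (allFin (suc k)) (λ t → unitVec t * f t) ≡ f zero
∑-unitVec {k} f = begin
  ∑ (allFin (suc k)) (λ t → unitVec t * f t)           ≡⟨ ∑-allFin-suc (λ t → unitVec t * f t) ⟩
  1ℚ * f zero + ∑ (allFin k) (λ t → 0ℚ * f (suc t))    ≡⟨ cong₂ _+_ (*-identityˡ (f zero)) (∑-zero (allFin k) (All.universal (λ t → *-zeroˡ (f (suc t))) _)) ⟩
  f zero + 0ℚ                                          ≡⟨ +-identityʳ _ ⟩
  f zero                                               ∎
  where open ≡-Reasoning

-- Gaussian elimination: the vector with index zero serves as pivot row.
dependence : ∀ {E : Set} k (es : List E) (u : Fin k → E → ℚ) → length es ℕ.< k →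
  Σ (Fin k → ℚ) λ a → (∃ λ t → a t ≢ 0ℚ) × (∀ {e} → e ∈ es → ∑ (allFin k) (λ t → a t * u t e) ≡ 0ℚ)
dependence {E} (suc k) es u (s≤s |es|≤k) with any? (λ e → ¬? (u zero e ≟ 0ℚ)) es
-- The pivot row vanishes on all of `es`, so it is a dependence by itself.
... | no none = unitVec , (zero , λ ()) , λ {e} e∈es → trans (∑-unitVec (λ t → u t e))
                  (decidable-stable (u zero e ≟ 0ℚ) (λ nz → none (lose e∈es nz)))
... | yes some with e₀ , e₀∈es , u₀≢0 ← find some with ys , zs , refl ← ∈-∃++ e₀∈es = a , nonzero , a-kills
  where
  open ≡-Reasoning
  instance nz = ≢-nonZero u₀≢0
  -- Subtracting `r t` times the pivot row clears the entry at `e₀`, so `e₀` can leave the list for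
  -- the recursive call.
  r : Fin k → ℚ
  r t = u (suc t) e₀ * 1/ u zero e₀
  v : Fin k → E → ℚ
  v t e = u (suc t) e - r t * u zero e
  ih = dependence k (ys ++ zs) v (subst (ℕ._≤ k) (length-remove ys) |es|≤k)
  b = proj₁ ih
  a : Fin (suc k) → ℚ
  -- The pivot row gathers all the subtracted multiples, which makes the combination of the rows `u`
  -- equal to that of the rows `v`.
  a zero    = - ∑ (allFin k) (λ t → b t * r t)
  a (suc t) = b t
  nonzero : ∃ λ t → a t ≢ 0ℚ
  nonzero = let t , bt≢0 = proj₁ (proj₂ ih) in suc t , bt≢0
  combination : ∀ e → ∑ (allFin (suc k)) (λ t → a t * u t e) ≡ ∑ (allFin k) (λ t → b t * v t e)
  combination e = begin
    ∑ (allFin (suc k)) (λ t → a t * u t e)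
      ≡⟨ ∑-allFin-suc (λ t → a t * u t e) ⟩
    - B * w + ∑ (allFin k) (λ t → b t * u (suc t) e)
      ≡⟨ cong (_+ ∑ (allFin k) (λ t → b t * u (suc t) e)) (trans (solve 2 (λ x y → :- x :* y := (:- y) :* x) refl B w) (*-distribˡ-∑ (allFin k) (- w) _)) ⟩
    ∑ (allFin k) (λ t → - w * (b t * r t)) + ∑ (allFin k) (λ t → b t * u (suc t) e)
      ≡⟨ ∑-distrib-+ (allFin k) _ _ ⟨
    ∑ (allFin k) (λ t → - w * (b t * r t) + b t * u (suc t) e)
      ≡⟨ ∑-cong (allFin k) (λ t → solve 4 (λ w b r x → (:- w) :* (b :* r) :+ b :* x := b :* (x :- r :* w)) refl w (b t) (r t) (u (suc t) e)) ⟩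
    ∑ (allFin k) (λ t → b t * v t e) ∎
    where
    B = ∑ (allFin k) (λ t → b t * r t)
    w = u zero e
  v-e₀ : ∀ t → v t e₀ ≡ 0ℚ
  v-e₀ t = begin
    x - x * 1/ w * w    ≡⟨ cong (λ y → x - y) (*-assoc x (1/ w) w) ⟩
    x - x * (1/ w * w)  ≡⟨ cong (λ y → x - x * y) (*-inverseˡ w) ⟩
    x - x * 1ℚ          ≡⟨ cong (λ y → x - y) (*-identityʳ x) ⟩
    x - x               ≡⟨ +-inverseʳ x ⟩
    0ℚ                  ∎
    where
    x = u (suc t) e₀
    w = u zero e₀
  a-kills : ∀ {e} → e ∈ ys ++ [ e₀ ] ++ zs → ∑ (allFin (suc k)) (λ t → a t * u t e) ≡ 0ℚ
  a-kills {e} e∈ with ∈-remove ys e∈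
  ... | inj₁ refl = trans (combination e₀) (∑-zero (allFin k) (All.universal (λ t → trans (cong (b t *_) (v-e₀ t)) (*-zeroʳ (b t))) _))
  ... | inj₂ e∈′  = trans (combination e) (proj₂ (proj₂ ih) e∈′)

-- Lists without repetition, and the enumeration of the edges.

module _ {A : Set} {x : A} where

  Unique-remove : ∀ (ys : List A) {zs} → Unique (ys ++ [ x ] ++ zs) → Unique (ys ++ zs) × x ∉ ys ++ zs
  Unique-remove []       (x∉zs ∷ unique) = unique , λ x∈ → All.lookup x∉zs x∈ refl
  Unique-remove (y ∷ ys) (y∉ ∷ unique) with Unique-remove ys unique
  ... | unique′ , x∉ = All.tabulate (λ z∈ → All.lookup y∉ (weaken z∈)) ∷ unique′ ,
    λ { (here refl) → All.lookup y∉ (∈-++⁺ʳ ys (here refl)) refl ; (there x∈) → x∉ x∈ }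
    where
    weaken : ∀ {z} {zs} → z ∈ ys ++ zs → z ∈ ys ++ [ x ] ++ zs
    weaken z∈ with ∈-++⁻ ys z∈
    ... | inj₁ z∈ys = ∈-++⁺ˡ z∈ys
    ... | inj₂ z∈zs = ∈-++⁺ʳ ys (there z∈zs)

lookup-injective : ∀ {A : Set} {xs : List A} → Unique xs → ∀ {s t} → List.lookup xs s ≡ List.lookup xs t → s ≡ t
lookup-injective (_ ∷ _)      {zero}  {zero}  _  = refl
lookup-injective (x∉ ∷ _)     {zero}  {suc t} eq = contradiction eq (All.lookup x∉ (∈-lookup t))
lookup-injective (x∉ ∷ _)     {suc s} {zero}  eq = contradiction (sym eq) (All.lookup x∉ (∈-lookup s))
lookup-injective (_ ∷ unique) {suc s} {suc t} eq = cong suc (lookup-injective unique eq)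

-- `pick` is local to the definition of `edges`; unification recovers it.
edges-form : ∀ n → Σ (Fin n → Fin n → List (Edge n)) λ pick →
             edges n ≡ concatMap (λ a → concatMap (λ b → pick a b) (allFin n)) (allFin n)
edges-form n = _ , refl

pick : ∀ {n} → Fin n → Fin n → List (Edge n)
pick {n} = proj₁ (edges-form n)

pick-< : ∀ {n} {a b : Fin n} (a<b : a Fin.< b) → pick a b ≡ edge a b a<b ∷ []
pick-< {n} {a} {b} a<b with a <? b
... | yes p   = cong (λ q → edge a b q ∷ []) (ℕ.≤-irrelevant p a<b)
... | no  a≮b = contradiction a<b a≮b

∈-pick⁻ : ∀ {n} {a b : Fin n} {e} → e ∈ pick a b → a ≡ Edge.i e × b ≡ Edge.j e
∈-pick⁻ {n} {a} {b} e∈ with a <? b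
∈-pick⁻ (here refl) | yes _ = refl , refl

pick-Unique : ∀ {n} (a b : Fin n) → Unique (pick a b)
pick-Unique a b with a <? b
... | yes _ = [] ∷ []
... | no  _ = []

-- The count is phrased with `does`, which computes on the constructors of `Fin`; `countPairs`
-- relies on this to split off a vertex definitionally.
length-pick : ∀ {n} (a b : Fin n) → length (pick a b) ≡ (if does (a <? b) then 1 else 0)
length-pick a b = trans isYes-version (cong (if_then 1 else 0) (isYes≗does (a <? b)))
  where
  isYes-version : length (pick a b) ≡ (if isYes (a <? b) then 1 else 0)
  isYes-version with a <? b
  ... | yes _ = refl
  ... | no  _ = refl

∈-edges : ∀ {n} (e : Edge n) → e ∈ edges n
∈-edges (edge a b a<b) = ∈-concatMap⁺ _ (lose (∈-allFin a) (∈-concatMap⁺ _ (lose (∈-allFin b)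
  (subst (edge a b a<b ∈_) (sym (pick-< a<b)) (here refl)))))

Unique-concatMap : ∀ {A B : Set} (f : A → List B) → (∀ x → Unique (f x)) →
  (∀ {x y z} → z ∈ f x → z ∈ f y → x ≡ y) → ∀ {xs} → Unique xs → Unique (concatMap f xs)
Unique-concatMap f f-unique disjoint []            = []
Unique-concatMap f f-unique disjoint {x ∷ xs} (x∉xs ∷ unique) =
  ++⁺ (f-unique x) (Unique-concatMap f f-unique disjoint unique) λ (z∈fx , z∈rest) →
    let y , y∈xs , z∈fy = find (∈-concatMap⁻ f z∈rest) in
    All.lookup x∉xs y∈xs (disjoint z∈fx z∈fy)

-- An edge records both endpoints, so the blocks belonging to different endpoints have no edge in
-- common.
edges-Unique : ∀ n → Unique (edges n)
edges-Unique n = Unique-concatMap _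
  (λ a → Unique-concatMap _ (pick-Unique a) (λ e∈ e∈′ → trans (proj₂ (∈-pick⁻ e∈)) (sym (proj₂ (∈-pick⁻ e∈′)))) (allFin⁺ n))
  (λ e∈ e∈′ → trans (source e∈) (sym (source e∈′))) (allFin⁺ n)
  where
  source : ∀ {a e} → e ∈ concatMap (pick a) (allFin n) → a ≡ Edge.i e
  source {a} e∈ = let b , e∈′ = satisfied (∈-concatMap⁻ (pick a) {xs = allFin n} e∈) in proj₁ (∈-pick⁻ {b = b} e∈′)

sumℕ : ∀ {n} → (Fin n → ℕ) → ℕ
sumℕ {zero}  f = 0
sumℕ {suc n} f = f zero ℕ.+ sumℕ (f ∘ suc)

sumℕ-cong : ∀ {n} {f g : Fin n → ℕ} → (∀ t → f t ≡ g t) → sumℕ f ≡ sumℕ g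
sumℕ-cong {zero}  f≗g = refl
sumℕ-cong {suc n} f≗g = cong₂ ℕ._+_ (f≗g zero) (sumℕ-cong (f≗g ∘ suc))

sumℕ-1 : ∀ n → sumℕ {n} (λ _ → 1) ≡ n
sumℕ-1 zero    = refl
sumℕ-1 (suc n) = cong suc (sumℕ-1 n)

length-concatMap-tabulate : ∀ {n} {A B : Set} (f : A → List B) (g : Fin n → A) →
  length (concatMap f (tabulate g)) ≡ sumℕ (λ t → length (f (g t)))
length-concatMap-tabulate {zero}  f g = refl
length-concatMap-tabulate {suc n} f g = trans (length-++ (f (g zero)))
  (cong (length (f (g zero)) ℕ.+_) (length-concatMap-tabulate f (g ∘ suc)))

-- Vertex `zero` precedes each of the `n` others and follows none of them; the rest is the count for
-- `n` vertices, and Pascal's rule adds the two.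
countPairs : ∀ n → sumℕ {n} (λ a → sumℕ {n} (λ b → if does (a <? b) then 1 else 0)) ≡ n C 2
countPairs zero    = refl
countPairs (suc n) = begin
  sumℕ {n} (λ _ → 1) ℕ.+ sumℕ {n} (λ a → sumℕ {n} (λ b → if does (a <? b) then 1 else 0))
    ≡⟨ cong₂ ℕ._+_ (trans (sumℕ-1 n) (sym (nC1≡n n))) (countPairs n) ⟩
  n C 1 ℕ.+ n C 2  ≡⟨ nCk+nC[k+1]≡[n+1]C[k+1] n 1 ⟩
  suc n C 2        ∎
  where open ≡-Reasoning

length-edges : ∀ n → length (edges n) ≡ n C 2
length-edges n = begin
  length (edges n)
    ≡⟨ length-concatMap-tabulate (λ a → concatMap (pick a) (allFin n)) (λ a → a) ⟩
  sumℕ (λ a → length (concatMap (pick a) (allFin n)))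
    ≡⟨ sumℕ-cong {n} (λ a → trans (length-concatMap-tabulate (pick a) (λ b → b)) (sumℕ-cong {n} (length-pick a))) ⟩
  sumℕ {n} (λ a → sumℕ {n} (λ b → if does (a <? b) then 1 else 0))
    ≡⟨ countPairs n ⟩
  n C 2 ∎
  where open ≡-Reasoning

-- Cut vectors, and linear equations as bounds on the dimension.

edge-≡ : ∀ {n} {e f : Edge n} → Edge.i e ≡ Edge.i f → Edge.j e ≡ Edge.j f → e ≡ f
edge-≡ {e = edge i j p} {edge .i .j q} refl refl = cong (edge i j) (ℕ.≤-irrelevant p q)

_≟ₑ_ : ∀ {n} (e f : Edge n) → Dec (e ≡ f)
e ≟ₑ f with Edge.i e Fin.≟ Edge.i f | Edge.j e Fin.≟ Edge.j f
... | yes i≡ | yes j≡ = yes (edge-≡ i≡ j≡)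
... | no  i≢ | _      = no (i≢ ∘ cong Edge.i)
... | _      | no  j≢ = no (j≢ ∘ cong Edge.j)

-- The Boolean behind a cut vector: `cutVec S e` reduces to `𝟙 (crosses S e)`, so pointwise claims
-- about cut vectors become truth tables.
crosses : ∀ {n} → Subset n → Edge n → Bool
crosses S e = lookup S (Edge.i e) xor lookup S (Edge.j e)

𝟙 : Bool → ℚ
𝟙 b = if b then 1ℚ else 0ℚ

2ℚ : ℚ
2ℚ = 1ℚ + 1ℚ

⟨⟩-cong : ∀ {n} (c : Vector n) {v w : Vector n} → (∀ e → v e ≡ w e) → ⟨ c , v ⟩ ≡ ⟨ c , w ⟩
⟨⟩-cong {n} c v≗w = ∑-cong (edges n) (λ e → cong (c e *_) (v≗w e))

⟨⟩-+ : ∀ {n} (c d w : Vector n) → ⟨ (λ e → c e + d e) , w ⟩ ≡ ⟨ c , w ⟩ + ⟨ d , w ⟩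
⟨⟩-+ {n} c d w = trans (∑-cong (edges n) (λ e → *-distribʳ-+ (w e) (c e) (d e))) (∑-distrib-+ (edges n) _ _)

-- Elimination on the coordinates `es` leaves a nontrivial combination supported at most at `e₀`,
-- and there the equation given by `L` forces it to vanish. The third alternative of `covered`
-- admits coordinates at which every vector of the family is zero.
kernel-dependent : ∀ {n k} (L : Vector n) (u : Fin k → Vector n) → (∀ t → ⟨ L , u t ⟩ ≡ 0ℚ) →
  ∀ {e₀} → L e₀ ≢ 0ℚ → (es : List (Edge n)) → length es ℕ.< k →
  (∀ e → e ≡ e₀ ⊎ e ∈ es ⊎ (∀ t → u t e ≡ 0ℚ)) → ¬ LinIndep u
kernel-dependent {n} {k} L u Lu≡0 {e₀} Le₀≢0 es |es|<k covered independent
  with a , (t , at≢0) , a-kills ← dependence k es u |es|<k = at≢0 (independent a v≡0 t)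
  where
  open ≡-Reasoning
  v : Vector n
  v e = ∑ (allFin k) (λ t → a t * u t e)
  v≡0-off : ∀ e → e ≢ e₀ → v e ≡ 0ℚ
  v≡0-off e e≢e₀ with covered e
  ... | inj₁ e≡e₀        = contradiction e≡e₀ e≢e₀
  ... | inj₂ (inj₁ e∈es) = a-kills e∈es
  ... | inj₂ (inj₂ ue≡0) = ∑-zero (allFin k) (All.universal (λ t → trans (cong (a t *_) (ue≡0 t)) (*-zeroʳ (a t))) _)
  Lv≡0 : ⟨ L , v ⟩ ≡ 0ℚ
  Lv≡0 = begin
    ⟨ L , v ⟩
      ≡⟨ ∑-cong (edges n) (λ e → *-distribˡ-∑ (allFin k) (L e) _) ⟩
    ∑ (edges n) (λ e → ∑ (allFin k) (λ t → L e * (a t * u t e)))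
      ≡⟨ ∑-swap (edges n) (allFin k) _ ⟩
    ∑ (allFin k) (λ t → ∑ (edges n) (λ e → L e * (a t * u t e)))
      ≡⟨ ∑-zero (allFin k) (All.universal term _) ⟩
    0ℚ ∎
    where
    term : ∀ t → ∑ (edges n) (λ e → L e * (a t * u t e)) ≡ 0ℚ
    term t = begin
      ∑ (edges n) (λ e → L e * (a t * u t e))
        ≡⟨ ∑-cong (edges n) (λ e → solve 3 (λ x y z → x :* (y :* z) := y :* (x :* z)) refl (L e) (a t) (u t e)) ⟩
      ∑ (edges n) (λ e → a t * (L e * u t e))
        ≡⟨ *-distribˡ-∑ (edges n) (a t) _ ⟨
      a t * ⟨ L , u t ⟩
        ≡⟨ cong (a t *_) (Lu≡0 t) ⟩
      a t * 0ℚ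
        ≡⟨ *-zeroʳ (a t) ⟩
      0ℚ ∎
  v≡0 : ∀ e → v e ≡ 0ℚ
  v≡0 e with e ≟ₑ e₀
  ... | no  e≢e₀ = v≡0-off e e≢e₀
  ... | yes refl = *-cancelˡ-≡0 Le₀≢0 (trans (sym (∑-single (edges-Unique n) (∈-edges e₀)
                     (λ y y≢e₀ → trans (cong (L y *_) (v≡0-off y y≢e₀)) (*-zeroʳ (L y))))) Lv≡0)

-- The coefficient vector of the functional L.
cutDiff : ∀ {n} → Subset n → Subset n → Vector n
cutDiff X Y e = cutVec X e - cutVec Y e

cutDiff≢0 : ∀ {n} {X Y : Subset n} {e} → crosses X e ≢ crosses Y e → cutDiff X Y e ≢ 0ℚ
cutDiff≢0 {X = X} {Y} {e} x≢y with crosses X e | crosses Y e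
... | false | false = contradiction refl x≢y
... | false | true  = λ ()
... | true  | false = λ ()
... | true  | true  = contradiction refl x≢y

-- Each of the two cuts is a competitor in the cone of the other, which gives both inequalities
-- between their weights.
cutDiff-annihilates : ∀ {n} {X Y : Subset n} → IsCut X → IsCut Y →
  ∀ {c} → KmaxPlus X c × KmaxPlus Y c → ⟨ cutDiff X Y , c ⟩ ≡ 0ℚ
cutDiff-annihilates {n} {X} {Y} X-cut Y-cut {c} ((_ , X-max) , (_ , Y-max)) = begin
  ⟨ cutDiff X Y , c ⟩
    ≡⟨ ∑-cong (edges n) (λ e → solve 3 (λ x y c → (x :- y) :* c := c :* x :- c :* y) refl (cutVec X e) (cutVec Y e) (c e)) ⟩
  ∑ (edges n) (λ e → c e * cutVec X e - c e * cutVec Y e)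
    ≡⟨ ∑-distrib-minus (edges n) _ _ ⟩
  ⟨ c , cutVec X ⟩ - ⟨ c , cutVec Y ⟩
    ≡⟨ cong (_- ⟨ c , cutVec Y ⟩) (≤-antisym (Y-max X X-cut) (X-max Y Y-cut)) ⟩
  ⟨ c , cutVec Y ⟩ - ⟨ c , cutVec Y ⟩
    ≡⟨ +-inverseʳ ⟨ c , cutVec Y ⟩ ⟩
  0ℚ ∎
  where open ≡-Reasoning

-- Sufficiency: d - 1 independent vectors common to both cones.

δ : ∀ {n} → Edge n → Vector n
δ e f = 𝟙 (does (e ≟ₑ f))

δ-refl : ∀ {n} (e : Edge n) → δ e e ≡ 1ℚ
δ-refl e = cong 𝟙 (dec-true (e ≟ₑ e) refl)

δ-≢ : ∀ {n} {e f : Edge n} → e ≢ f → δ e f ≡ 0ℚ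
δ-≢ {e = e} {f} e≢f = cong 𝟙 (dec-false (e ≟ₑ f) e≢f)

⟨δ,⟩ : ∀ {n} (e : Edge n) (w : Vector n) → ⟨ δ e , w ⟩ ≡ w e
⟨δ,⟩ {n} e w = trans (∑-single (edges-Unique n) (∈-edges e) (λ f f≢e → trans (cong (_* w f) (δ-≢ (f≢e ∘ sym))) (*-zeroˡ (w f))))
  (trans (cong (_* w e) (δ-refl e)) (*-identityˡ (w e)))

0≤𝟙 : ∀ b → 0ℚ ≤ 𝟙 b
0≤𝟙 true  = from-yes (0ℚ ≤? 1ℚ)
0≤𝟙 false = ≤-refl

𝟙≤1 : ∀ b → 𝟙 b ≤ 1ℚ
𝟙≤1 true  = ≤-refl
𝟙≤1 false = from-yes (0ℚ ≤? 1ℚ)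

-- Both sufficient conditions reach the construction through `rigid`: only the cut vectors of `X`
-- and `Y` contain every strong edge. The edges `e⁺` and `e⁻` serve to balance the perturbations.
module Adjacency {n : ℕ} (X Y : Subset n) (X-cut : IsCut X) (Y-cut : IsCut Y) (e⁺ e⁻ : Edge n)
  (X⁺ : crosses X e⁺ ≡ true)  (Y⁺ : crosses Y e⁺ ≡ false)
  (X⁻ : crosses X e⁻ ≡ false) (Y⁻ : crosses Y e⁻ ≡ true)
  (rigid : ∀ Z → (∀ e → crosses X e ≡ true → crosses Y e ≡ true → crosses Z e ≡ true) →
           (∀ e → crosses Z e ≡ crosses X e) ⊎ (∀ e → crosses Z e ≡ crosses Y e))
  where

  e⁺≢e⁻ : e⁺ ≢ e⁻
  e⁺≢e⁻ e⁺≡e⁻ with () ← trans (sym X⁺) (trans (cong (crosses X) e⁺≡e⁻) X⁻)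

  strong : Edge n → Bool
  strong f = crosses X f ∧ crosses Y f

  -- The weight 2 is matched to the bound `2ℚ` on perturbations: one missed strong edge already
  -- costs as much as a perturbation can gain.
  backbone : Vector n
  backbone f = 𝟙 (strong f) + 𝟙 (strong f)

  -- What has to be added to an edge to reach the kernel of L. The arguments are the two Booleans
  -- `crosses X e` and `crosses Y e`, so that proofs can proceed by cases on them.
  partner′ : Bool → Bool → Vector n
  partner′ true  false = δ e⁻
  partner′ false true  = δ e⁺
  partner′ _     _     = λ _ → 0ℚ

  partner : Edge n → Vector n
  partner e = partner′ (crosses X e) (crosses Y e)

  generator : Edge n → Vector n
  generator e f = backbone f + (δ e f + partner e f)

  partner-≢ : ∀ e {f} → f ≢ e⁺ → f ≢ e⁻ → partner e f ≡ 0ℚ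
  partner-≢ e f≢e⁺ f≢e⁻ with crosses X e | crosses Y e
  ... | true  | true  = refl
  ... | true  | false = δ-≢ (f≢e⁻ ∘ sym)
  ... | false | true  = δ-≢ (f≢e⁺ ∘ sym)
  ... | false | false = refl

  -- Fixes the order of elimination in the independence proof: besides the generator of `e⁺` itself,
  -- only edges cut by `Y` alone contribute to the coordinate `e⁺`.
  partner-e⁺ : ∀ e → (crosses X e ≡ false × crosses Y e ≡ true) ⊎ partner e e⁺ ≡ 0ℚ
  partner-e⁺ e with crosses X e | crosses Y e
  ... | true  | true  = inj₂ refl
  ... | true  | false = inj₂ (δ-≢ (e⁺≢e⁻ ∘ sym))
  ... | false | true  = inj₁ (refl , refl)
  ... | false | false = inj₂ refl

  -- The partner's pairing with a cut vector, whose values at e⁻ and e⁺ are p and q.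
  partnerVal : Bool → Bool → ℚ → ℚ → ℚ
  partnerVal true  false p q = p
  partnerVal false true  p q = q
  partnerVal _     _     p q = 0ℚ

  ⟨zero,⟩ : ∀ (w : Vector n) → ⟨ (λ _ → 0ℚ) , w ⟩ ≡ 0ℚ
  ⟨zero,⟩ w = ∑-zero (edges n) (All.universal (λ e → *-zeroˡ (w e)) _)

  ⟨partner,⟩ : ∀ x y (w : Vector n) → ⟨ partner′ x y , w ⟩ ≡ partnerVal x y (w e⁻) (w e⁺)
  ⟨partner,⟩ true  true  w = ⟨zero,⟩ w
  ⟨partner,⟩ true  false w = ⟨δ,⟩ e⁻ w
  ⟨partner,⟩ false true  w = ⟨δ,⟩ e⁺ w
  ⟨partner,⟩ false false w = ⟨zero,⟩ w

  perturbation : Edge n → Subset n → ℚ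
  perturbation e S = cutVec S e + partnerVal (crosses X e) (crosses Y e) (cutVec S e⁻) (cutVec S e⁺)

  ⟨generator,⟩ : ∀ e S → ⟨ generator e , cutVec S ⟩ ≡ ⟨ backbone , cutVec S ⟩ + perturbation e S
  ⟨generator,⟩ e S = trans (⟨⟩-+ backbone _ (cutVec S)) (cong (⟨ backbone , cutVec S ⟩ +_)
    (trans (⟨⟩-+ (δ e) (partner e) (cutVec S))
      (cong₂ _+_ (⟨δ,⟩ e (cutVec S)) (⟨partner,⟩ (crosses X e) (crosses Y e) (cutVec S)))))

  perturbation≥0 : ∀ e S → 0ℚ ≤ perturbation e S
  perturbation≥0 e S = +-mono-≤ (0≤𝟙 (crosses S e)) (lemma (crosses X e) (crosses Y e))
    where
    lemma : ∀ x y → 0ℚ ≤ partnerVal x y (cutVec S e⁻) (cutVec S e⁺)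
    lemma true  true  = ≤-refl
    lemma true  false = 0≤𝟙 (crosses S e⁻)
    lemma false true  = 0≤𝟙 (crosses S e⁺)
    lemma false false = ≤-refl

  perturbation≤2 : ∀ e S → perturbation e S ≤ 2ℚ
  perturbation≤2 e S = +-mono-≤ (𝟙≤1 (crosses S e)) (lemma (crosses X e) (crosses Y e))
    where
    lemma : ∀ x y → partnerVal x y (cutVec S e⁻) (cutVec S e⁺) ≤ 1ℚ
    lemma true  true  = 𝟙≤1 false
    lemma true  false = 𝟙≤1 (crosses S e⁻)
    lemma false true  = 𝟙≤1 (crosses S e⁺)
    lemma false false = 𝟙≤1 false

  -- The perturbation lies in the kernel of L: what one cut gains at `e`, the other regains at the
  -- partner edge.
  perturbation-balanced : ∀ e → perturbation e X ≡ perturbation e Y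
  perturbation-balanced e = lemma (crosses X e) (crosses Y e)
    where
    lemma : ∀ x y → 𝟙 x + partnerVal x y (cutVec X e⁻) (cutVec X e⁺) ≡ 𝟙 y + partnerVal x y (cutVec Y e⁻) (cutVec Y e⁺)
    lemma true  true  = refl
    lemma true  false = trans (cong (λ b → 1ℚ + 𝟙 b) X⁻) (sym (cong (λ b → 0ℚ + 𝟙 b) Y⁻))
    lemma false true  = trans (cong (λ b → 0ℚ + 𝟙 b) X⁺) (sym (cong (λ b → 1ℚ + 𝟙 b) Y⁺))
    lemma false false = refl

  backbone-balanced : ⟨ backbone , cutVec X ⟩ ≡ ⟨ backbone , cutVec Y ⟩
  backbone-balanced = ∑-cong (edges n) λ f → table (crosses X f) (crosses Y f)
    where
    table : ∀ x y → (𝟙 (x ∧ y) + 𝟙 (x ∧ y)) * 𝟙 x ≡ (𝟙 (x ∧ y) + 𝟙 (x ∧ y)) * 𝟙 y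
    table true  true  = refl
    table true  false = refl
    table false true  = refl
    table false false = refl

  generator-balanced : ∀ e → ⟨ generator e , cutVec X ⟩ ≡ ⟨ generator e , cutVec Y ⟩
  generator-balanced e = trans (⟨generator,⟩ e X)
    (trans (cong₂ _+_ backbone-balanced (perturbation-balanced e)) (sym (⟨generator,⟩ e Y)))

  -- `X` cuts every strong edge, so no edge contributes negatively to the difference, and the missed
  -- edge `f` alone contributes 2.
  backbone-gap : ∀ Z {f} → crosses X f ≡ true → crosses Y f ≡ true → crosses Z f ≡ false →
                 ⟨ backbone , cutVec Z ⟩ + 2ℚ ≤ ⟨ backbone , cutVec X ⟩
  backbone-gap Z {f} Xf Yf Zf = begin
    ⟨ backbone , cutVec Z ⟩ + 2ℚ
      ≡⟨ cong (⟨ backbone , cutVec Z ⟩ +_) gap-f ⟨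
    ⟨ backbone , cutVec Z ⟩ + gap f
      ≤⟨ +-monoʳ-≤ ⟨ backbone , cutVec Z ⟩ (term≤∑ gap≥0 (∈-edges f)) ⟩
    ⟨ backbone , cutVec Z ⟩ + ∑ (edges n) gap
      ≡⟨ ∑-distrib-+ (edges n) _ gap ⟨
    ∑ (edges n) (λ g → backbone g * cutVec Z g + gap g)
      ≡⟨ ∑-cong (edges n) (λ g → solve 3 (λ b x z → b :* z :+ b :* (x :- z) := b :* x) refl (backbone g) (cutVec X g) (cutVec Z g)) ⟩
    ⟨ backbone , cutVec X ⟩ ∎
    where
    open ≤-Reasoning
    gap : Vector n
    gap g = backbone g * (cutVec X g - cutVec Z g)
    gap-f : gap f ≡ 2ℚ
    gap-f rewrite Xf | Yf | Zf = refl
    table : ∀ x y z → 0ℚ ≤ (𝟙 (x ∧ y) + 𝟙 (x ∧ y)) * (𝟙 x - 𝟙 z)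
    table true  true  true  = ≤-refl
    table true  true  false = from-yes (0ℚ ≤? 2ℚ)
    table true  false true  = ≤-refl
    table true  false false = ≤-refl
    table false _     true  = ≤-refl
    table false _     false = ≤-refl
    gap≥0 : ∀ g → 0ℚ ≤ gap g
    gap≥0 g = table (crosses X g) (crosses Y g) (crosses Z g)

  misses? : ∀ Z f → Dec (crosses X f ≡ true × crosses Y f ≡ true × crosses Z f ≡ false)
  misses? Z f = crosses X f Bool.≟ true ×-dec crosses Y f Bool.≟ true ×-dec crosses Z f Bool.≟ false

  generator-max : ∀ e Z → ⟨ generator e , cutVec Z ⟩ ≤ ⟨ generator e , cutVec X ⟩
  generator-max e Z with any? (misses? Z) (edges n)
  -- The loss of 2 covers the largest perturbation of `Z`, while the perturbation of `X` is
  -- nonnegative.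
  ... | yes missed = let f , _ , Xf , Yf , Zf = find missed in begin
    ⟨ generator e , cutVec Z ⟩
      ≡⟨ ⟨generator,⟩ e Z ⟩
    ⟨ backbone , cutVec Z ⟩ + perturbation e Z
      ≤⟨ +-monoʳ-≤ ⟨ backbone , cutVec Z ⟩ (perturbation≤2 e Z) ⟩
    ⟨ backbone , cutVec Z ⟩ + 2ℚ
      ≤⟨ backbone-gap Z {f} Xf Yf Zf ⟩
    ⟨ backbone , cutVec X ⟩
      ≡⟨ +-identityʳ ⟨ backbone , cutVec X ⟩ ⟨
    ⟨ backbone , cutVec X ⟩ + 0ℚ
      ≤⟨ +-monoʳ-≤ ⟨ backbone , cutVec X ⟩ (perturbation≥0 e X) ⟩
    ⟨ backbone , cutVec X ⟩ + perturbation e X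
      ≡⟨ ⟨generator,⟩ e X ⟨
    ⟨ generator e , cutVec X ⟩ ∎
    where open ≤-Reasoning
  ... | no none with rigid Z (λ f Xf Yf → Bool.¬-not (λ Zf → none (lose (∈-edges f) (Xf , Yf , Zf))))
  ... | inj₁ Z≗X = ≤-reflexive (⟨⟩-cong (generator e) (λ f → cong 𝟙 (Z≗X f)))
  ... | inj₂ Z≗Y = ≤-reflexive (trans (⟨⟩-cong (generator e) (λ f → cong 𝟙 (Z≗Y f))) (sym (generator-balanced e)))

  generator≥0 : ∀ e f → 0ℚ ≤ generator e f
  generator≥0 e f = +-mono-≤ (+-mono-≤ (0≤𝟙 (strong f)) (0≤𝟙 (strong f)))
    (+-mono-≤ (0≤𝟙 (does (e ≟ₑ f))) (lemma (crosses X e) (crosses Y e)))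
    where
    lemma : ∀ x y → 0ℚ ≤ partner′ x y f
    lemma true  true  = ≤-refl
    lemma true  false = 0≤𝟙 (does (e⁻ ≟ₑ f))
    lemma false true  = 0≤𝟙 (does (e⁺ ≟ₑ f))
    lemma false false = ≤-refl

  generator-∈ : ∀ e → KmaxPlus X (generator e) × KmaxPlus Y (generator e)
  generator-∈ e = (generator≥0 e , λ Z _ → generator-max e Z) ,
    (generator≥0 e , λ Z _ → subst (⟨ generator e , cutVec Z ⟩ ≤_) (generator-balanced e) (generator-max e Z))

  module _ {es : List (Edge n)} (es-unique : Unique es) (e⁻∉es : e⁻ ∉ es) where

    ε : Fin (length es) → Edge n
    ε = List.lookup es

    ε≢e⁻ : ∀ s → ε s ≢ e⁻
    ε≢e⁻ s εs≡e⁻ = e⁻∉es (subst (_∈ es) εs≡e⁻ (∈-lookup s))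

    -- Call an edge weak if it is not strong. At weak edges other than `e⁺` only the diagonal entry
    -- survives, so those coefficients vanish; then the coordinate `e⁺` yields its own. At a strong
    -- edge every generator has the backbone entry 2, which leaves 2S + a s = 0 with S the sum of
    -- all coefficients, and it remains to show S = 0.
    generators-independent : LinIndep (generator ∘ ε)
    generators-independent a vanish = conclusion
      where
      open ≡-Reasoning
      k = length es
      S = ∑ (allFin k) a

      pick-coeff : ∀ s (w : Fin k → ℚ) → w s ≡ 1ℚ → (∀ t → t ≢ s → a t * w t ≡ 0ℚ) → ∑ (allFin k) (λ t → a t * w t) ≡ a s
      pick-coeff s w ws≡1 off = trans (∑-single (allFin⁺ k) (∈-allFin s) off) (trans (cong (a s *_) ws≡1) (*-identityʳ (a s)))

      δ-off : ∀ {s t} → t ≢ s → δ (ε t) (ε s) ≡ 0ℚ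
      δ-off t≢s = δ-≢ (t≢s ∘ lookup-injective es-unique)

      weak-term : ∀ s → strong (ε s) ≡ false → ∀ t → generator (ε t) (ε s) ≡ δ (ε t) (ε s) + partner (ε t) (ε s)
      weak-term s weak t = trans (cong (λ b → 𝟙 b + 𝟙 b + (δ (ε t) (ε s) + partner (ε t) (ε s))) weak) (+-identityˡ _)

      a-weak-≢e⁺ : ∀ s → strong (ε s) ≡ false → ε s ≢ e⁺ → a s ≡ 0ℚ
      a-weak-≢e⁺ s weak εs≢e⁺ = trans (sym (pick-coeff s (λ t → generator (ε t) (ε s))
          (trans (value s) (δ-refl (ε s)))
          (λ t t≢s → trans (cong (a t *_) (trans (value t) (δ-off t≢s))) (*-zeroʳ (a t)))))
        (vanish (ε s))
        where
        value : ∀ t → generator (ε t) (ε s) ≡ δ (ε t) (ε s)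
        value t = trans (weak-term s weak t) (trans (cong (δ (ε t) (ε s) +_) (partner-≢ (ε t) εs≢e⁺ (ε≢e⁻ s))) (+-identityʳ _))

      a-e⁺ : ∀ s → ε s ≡ e⁺ → a s ≡ 0ℚ
      a-e⁺ s εs≡e⁺ = trans (sym (pick-coeff s (λ t → generator (ε t) (ε s)) value off)) (vanish (ε s))
        where
        Xs : crosses X (ε s) ≡ true
        Xs = trans (cong (crosses X) εs≡e⁺) X⁺
        Ys : crosses Y (ε s) ≡ false
        Ys = trans (cong (crosses Y) εs≡e⁺) Y⁺
        weak : strong (ε s) ≡ false
        weak = cong₂ _∧_ Xs Ys
        value : generator (ε s) (ε s) ≡ 1ℚ
        value = begin
          generator (ε s) (ε s)
            ≡⟨ weak-term s weak s ⟩
          δ (ε s) (ε s) + partner (ε s) (ε s)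
            ≡⟨ cong₂ _+_ (δ-refl (ε s)) (trans (cong₂ (λ x y → partner′ x y (ε s)) Xs Ys) (δ-≢ (ε≢e⁻ s ∘ sym))) ⟩
          1ℚ ∎
        off : ∀ t → t ≢ s → a t * generator (ε t) (ε s) ≡ 0ℚ
        off t t≢s with partner-e⁺ (ε t)
        -- The edge `ε t` is weak and, since `t` differs from `s`, is not `e⁺`; its coefficient is
        -- already known to vanish.
        ... | inj₁ (Xt , Yt) = trans (cong (_* generator (ε t) (ε s)) (a-weak-≢e⁺ t (cong₂ _∧_ Xt Yt)
                (λ εt≡e⁺ → t≢s (lookup-injective es-unique (trans εt≡e⁺ (sym εs≡e⁺)))))) (*-zeroˡ (generator (ε t) (ε s)))
        ... | inj₂ partner≡0 = trans (cong (a t *_) (trans (weak-term s weak t)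
                (cong₂ _+_ (δ-off t≢s) (trans (cong (partner (ε t)) εs≡e⁺) partner≡0)))) (*-zeroʳ (a t))

      a-weak : ∀ s → strong (ε s) ≡ false → a s ≡ 0ℚ
      a-weak s weak with ε s ≟ₑ e⁺
      ... | yes εs≡e⁺ = a-e⁺ s εs≡e⁺
      ... | no  εs≢e⁺ = a-weak-≢e⁺ s weak εs≢e⁺

      a-strong : ∀ s → strong (ε s) ≡ true → S + S + a s ≡ 0ℚ
      a-strong s strong-s = begin
        S + S + a s
          ≡⟨ cong (S + S +_) (pick-coeff s (λ t → δ (ε t) (ε s)) (δ-refl (ε s)) (λ t t≢s → trans (cong (a t *_) (δ-off t≢s)) (*-zeroʳ (a t)))) ⟨
        S + S + ∑ (allFin k) (λ t → a t * δ (ε t) (ε s))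
          ≡⟨ cong (_+ ∑ (allFin k) (λ t → a t * δ (ε t) (ε s))) (∑-distrib-+ (allFin k) a a) ⟨
        ∑ (allFin k) (λ t → a t + a t) + ∑ (allFin k) (λ t → a t * δ (ε t) (ε s))
          ≡⟨ ∑-distrib-+ (allFin k) _ _ ⟨
        ∑ (allFin k) (λ t → a t + a t + a t * δ (ε t) (ε s))
          ≡⟨ ∑-cong (allFin k) term ⟩
        ∑ (allFin k) (λ t → a t * generator (ε t) (ε s))
          ≡⟨ vanish (ε s) ⟩
        0ℚ ∎
        where
        ε≢e⁺ : ε s ≢ e⁺
        ε≢e⁺ εs≡e⁺ with () ← trans (sym strong-s) (cong₂ _∧_ (trans (cong (crosses X) εs≡e⁺) X⁺) (trans (cong (crosses Y) εs≡e⁺) Y⁺))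
        term : ∀ t → a t + a t + a t * δ (ε t) (ε s) ≡ a t * generator (ε t) (ε s)
        term t = begin
          a t + a t + a t * d
            ≡⟨ cong (λ x → x + x + a t * d) (*-identityʳ (a t)) ⟨
          a t * 1ℚ + a t * 1ℚ + a t * d
            -- The constant `1ℚ` enters the polynomial identity as an indeterminate `o`.
            ≡⟨ solve 3 (λ a o d → a :* o :+ a :* o :+ a :* d := a :* (o :+ o :+ d)) refl (a t) 1ℚ d ⟩
          a t * (1ℚ + 1ℚ + d)
            ≡⟨ cong (a t *_) (cong₂ _+_ (sym (cong (λ b → 𝟙 b + 𝟙 b) strong-s)) (sym (trans (cong (d +_) (partner-≢ (ε t) ε≢e⁺ (ε≢e⁻ s))) (+-identityʳ d)))) ⟩
          a t * generator (ε t) (ε s) ∎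
          where d = δ (ε t) (ε s)

      -- a s is 0 off the strong edges and -2S on them, so S² = ∑ S a s ≤ 0.
      S≡0 : S ≡ 0ℚ
      S≡0 = square≡0 (≤-antisym SS≤0 (square≥0 S))
        where
        term≤0 : ∀ t → S * a t ≤ 0ℚ
        term≤0 t with strong (ε t) in st
        ... | false = ≤-reflexive (trans (cong (S *_) (a-weak t st)) (*-zeroʳ S))
        ... | true  = subst (_≤ 0ℚ) (sym Sa≡) (neg-antimono-≤ (+-mono-≤ (square≥0 S) (square≥0 S)))
          where
          Sa≡ : S * a t ≡ - (S * S + S * S)
          Sa≡ = begin
            S * a t                                     ≡⟨ solve 2 (λ s x → s :* x := s :* (s :+ s :+ x) :- (s :* s :+ s :* s)) refl S (a t) ⟩
            S * (S + S + a t) - (S * S + S * S)         ≡⟨ cong (_- (S * S + S * S)) (trans (cong (S *_) (a-strong t st)) (*-zeroʳ S)) ⟩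
            0ℚ - (S * S + S * S)                        ≡⟨ +-identityˡ _ ⟩
            - (S * S + S * S)                           ∎
        SS≤0 : S * S ≤ 0ℚ
        SS≤0 = subst₂ _≤_ (sym (*-distribˡ-∑ (allFin k) S a)) (∑-zero (allFin k) (All.universal (λ _ → refl) _))
                 (∑-mono-≤ (allFin k) term≤0)

      conclusion : ∀ s → a s ≡ 0ℚ
      conclusion s with strong (ε s) in st
      ... | false = a-weak s st
      ... | true  = begin
        a s          ≡⟨ +-identityˡ (a s) ⟨
        0ℚ + a s     ≡⟨ cong (λ x → x + x + a s) S≡0 ⟨
        S + S + a s  ≡⟨ a-strong s st ⟩
        0ℚ           ∎

  -- Deleting `e⁻` from the edge list leaves d - 1 edges, which index the generators. For the upper
  -- bound the same `e⁻` is the coordinate recovered from L = 0.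
  adjacent : Adjacent X Y
  adjacent with ys , zs , split ← ∈-∃++ (∈-edges e⁻) = subst (HasDim (λ c → KmaxPlus X c × KmaxPlus Y c)) (sym dim) hasDim
    where
    es = ys ++ zs
    |edges| : n C 2 ≡ suc (length es)
    |edges| = trans (sym (length-edges n)) (trans (cong length split) (length-remove ys))
    dim : n C 2 ℕ.∸ 1 ≡ length es
    dim = cong (ℕ._∸ 1) |edges|
    separated = Unique-remove ys (subst Unique split (edges-Unique n))
    covered : ∀ {k} (u : Fin k → Vector n) e → e ≡ e⁻ ⊎ e ∈ es ⊎ (∀ t → u t e ≡ 0ℚ)
    covered u e with ∈-remove ys (subst (e ∈_) split (∈-edges e))
    ... | inj₁ e≡e⁻ = inj₁ e≡e⁻
    ... | inj₂ e∈es = inj₂ (inj₁ e∈es)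
    hasDim : HasDim (λ c → KmaxPlus X c × KmaxPlus Y c) (length es)
    hasDim = (generator ∘ List.lookup es , generator-∈ ∘ List.lookup es , generators-independent (proj₁ separated) (proj₂ separated)) ,
      λ u u∈ → kernel-dependent (cutDiff X Y) u (λ t → cutDiff-annihilates {X = X} {Y} X-cut Y-cut {c = u t} (u∈ t))
        (cutDiff≢0 {X = X} {Y} {e⁻} (λ eq → Bool.not-¬ X⁻ (trans eq Y⁻))) es ℕ.≤-refl (covered u)

-- Adjacency depends only on the unordered pair of cut vectors.

HasDim-resp : ∀ {n m} (P Q : Vector n → Set) → (∀ c → P c → Q c) → (∀ c → Q c → P c) → HasDim P m → HasDim Q m
HasDim-resp P Q P⇒Q Q⇒P ((u , u∈P , independent) , maximal) =
  (u , (λ t → P⇒Q (u t) (u∈P t)) , independent) , λ v v∈Q → maximal v (λ t → Q⇒P (v t) (v∈Q t))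

KmaxPlus-resp : ∀ {n} {X X′ : Subset n} → (∀ e → crosses X e ≡ crosses X′ e) → ∀ {c} → KmaxPlus X c → KmaxPlus X′ c
KmaxPlus-resp X≗X′ {c} (c≥0 , X-max) =
  c≥0 , λ Z Z-cut → ≤-trans (X-max Z Z-cut) (≤-reflexive (⟨⟩-cong c (cong 𝟙 ∘ X≗X′)))

lookup-∁ : ∀ {n} (X : Subset n) i → lookup (∁ X) i ≡ not (lookup X i)
lookup-∁ X i = lookup-map i not X

not-xor-not : ∀ u v → not u xor not v ≡ u xor v
not-xor-not true  v = refl
not-xor-not false v = Bool.not-involutive v

crosses-∁ : ∀ {n} (X : Subset n) e → crosses X e ≡ crosses (∁ X) e
crosses-∁ X (edge i j _) = sym (trans (cong₂ _xor_ (lookup-∁ X i) (lookup-∁ X j)) (not-xor-not (lookup X i) (lookup X j)))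

Adjacent-sym : ∀ {n} {X Y : Subset n} → Adjacent X Y → Adjacent Y X
Adjacent-sym {X = X} {Y} = HasDim-resp (λ c → KmaxPlus X c × KmaxPlus Y c) (λ c → KmaxPlus Y c × KmaxPlus X c)
  (λ _ → swap) (λ _ → swap)

Adjacent-resp : ∀ {n} {X X′ Y Y′ : Subset n} → (∀ e → crosses X e ≡ crosses X′ e) → (∀ e → crosses Y e ≡ crosses Y′ e) →
  Adjacent X Y → Adjacent X′ Y′
Adjacent-resp {X = X} {X′} {Y} {Y′} X≗X′ Y≗Y′ =
  HasDim-resp (λ c → KmaxPlus X c × KmaxPlus Y c) (λ c → KmaxPlus X′ c × KmaxPlus Y′ c)
    (λ c (cX , cY) → KmaxPlus-resp {X = X} {X′} X≗X′ {c} cX , KmaxPlus-resp {X = Y} {Y′} Y≗Y′ {c} cY)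
    (λ c (cX , cY) → KmaxPlus-resp {X = X′} {X} (sym ∘ X≗X′) {c} cX , KmaxPlus-resp {X = Y′} {Y} (sym ∘ Y≗Y′) {c} cY)

-- Necessity: a second linear equation for nested cuts.

edgeBetween : ∀ {n} {p q : Fin n} → p ≢ q → Σ (Edge n) λ e → ∀ S → crosses S e ≡ lookup S p xor lookup S q
edgeBetween {p = p} {q} p≢q with Fin.<-cmp p q
... | tri< p<q _   _   = edge p q p<q , λ S → refl
... | tri≈ _   p≡q _   = contradiction p≡q p≢q
-- Edges are stored with increasing endpoints, so the pair is reversed here.
... | tri> _   _   q<p = edge q p q<p , λ S → Bool.xor-comm (lookup S q) (lookup S p)

-- The coordinate `e₀` is recovered from L = 0 and the coordinate `f` is always zero, so d - 2 edges
-- remain, too few for d - 1 independent vectors. That the cuts agree at `f` but not at `e₀` ensures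
-- that these edges are distinct.
extra-equation : ∀ {n} {X Y : Subset n} → IsCut X → IsCut Y → ∀ {e₀} → crosses X e₀ ≢ crosses Y e₀ →
  ∀ {f} → crosses X f ≡ crosses Y f → (∀ {c} → KmaxPlus X c × KmaxPlus Y c → c f ≡ 0ℚ) → ¬ Adjacent X Y
extra-equation {n} {X} {Y} X-cut Y-cut {e₀} e₀-differs {f} f-agrees c-f≡0 ((u , u∈ , independent) , _)
  with ys , zs , split ← ∈-∃++ (∈-edges e₀)
  with ∈-remove ys (subst (f ∈_) split (∈-edges f))
... | inj₁ f≡e₀ = e₀-differs (subst (λ e → crosses X e ≡ crosses Y e) f≡e₀ f-agrees)
... | inj₂ f∈ with ys′ , zs′ , split′ ← ∈-∃++ f∈ =
  kernel-dependent (cutDiff X Y) u (λ t → cutDiff-annihilates {X = X} {Y} X-cut Y-cut {c = u t} (u∈ t))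
    (cutDiff≢0 {X = X} {Y} {e₀} e₀-differs) (ys′ ++ zs′) (ℕ.≤-reflexive (sym dim)) covered independent
  where
  dim : n C 2 ℕ.∸ 1 ≡ suc (length (ys′ ++ zs′))
  dim = begin
    n C 2 ℕ.∸ 1                        ≡⟨ cong (ℕ._∸ 1) (length-edges n) ⟨
    length (edges n) ℕ.∸ 1             ≡⟨ cong (λ es → length es ℕ.∸ 1) split ⟩
    length (ys ++ e₀ ∷ zs) ℕ.∸ 1       ≡⟨ cong (ℕ._∸ 1) (length-remove ys) ⟩
    length (ys ++ zs)                  ≡⟨ cong length split′ ⟩
    length (ys′ ++ f ∷ zs′)            ≡⟨ length-remove ys′ ⟩
    suc (length (ys′ ++ zs′))          ∎
    where open ≡-Reasoning
  covered : ∀ e → e ≡ e₀ ⊎ e ∈ ys′ ++ zs′ ⊎ (∀ t → u t e ≡ 0ℚ)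
  covered e with ∈-remove ys (subst (e ∈_) split (∈-edges e))
  ... | inj₁ e≡e₀ = inj₁ e≡e₀
  ... | inj₂ e∈ with ∈-remove ys′ (subst (e ∈_) split′ e∈)
  ... | inj₁ refl = inj₂ (inj₂ (λ t → c-f≡0 {u t} (u∈ t)))
  ... | inj₂ e∈′  = inj₂ (inj₁ e∈′)

-- The possible memberships of a vertex in X ⊆ Y, X ∪ {p} and Y ─ {p}, where p ∈ Y ─ X.
data Pattern : Bool → Bool → Bool → Bool → Set where
  inner  : Pattern true  true  true  true
  middle : Pattern false true  false true
  pivot  : Pattern false true  true  false
  outer  : Pattern false false false false

-- Every case is an equality except `pivot` against `middle`: an edge from `p` to another vertex of
-- `Y ─ X` is cut by neither original set and by both modified ones.
uncross : ∀ {x y x⁺ y⁻ x′ y′ x⁺′ y⁻′} → Pattern x y x⁺ y⁻ → Pattern x′ y′ x⁺′ y⁻′ →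
  0ℚ ≤ 𝟙 (x⁺ xor x⁺′) + 𝟙 (y⁻ xor y⁻′) - (𝟙 (x xor x′) + 𝟙 (y xor y′))
uncross inner  inner  = ≤-refl
uncross inner  middle = ≤-refl
uncross inner  pivot  = ≤-refl
uncross inner  outer  = ≤-refl
uncross middle inner  = ≤-refl
uncross middle middle = ≤-refl
uncross middle pivot  = from-yes (0ℚ ≤? 2ℚ)
uncross middle outer  = ≤-refl
uncross pivot  inner  = ≤-refl
uncross pivot  middle = from-yes (0ℚ ≤? 2ℚ)
uncross pivot  pivot  = ≤-refl
uncross pivot  outer  = ≤-refl
uncross outer  inner  = ≤-refl
uncross outer  middle = ≤-refl
uncross outer  pivot  = ≤-refl
uncross outer  outer  = ≤-refl

∈-∁⁺ : ∀ {n} {X : Subset n} {i} → lookup X i ≡ false → Nonempty (∁ X)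
∈-∁⁺ {X = X} {i} Xi = i , lookup⇒[]= i (∁ X) (trans (lookup-∁ X i) (cong not Xi))

∈-∁⁻ : ∀ {n} {X : Subset n} → Nonempty (∁ X) → ∃ λ i → lookup X i ≡ false
∈-∁⁻ {X = X} (i , i∈) = i , Bool.not-injective (trans (sym (lookup-∁ X i)) ([]=⇒lookup i∈))

-- X ∪ {p} and Y ─ {p} together cut every edge at least as often as X and Y do, and pq twice more.
nested-vanishing : ∀ {n} {X Y : Subset n} → (∀ i → lookup X i ≡ true → lookup Y i ≡ true) →
  ∀ {p q} → p ≢ q → lookup X p ≡ false → lookup Y p ≡ true → lookup X q ≡ false → lookup Y q ≡ true →
  ∀ {f} → (∀ S → crosses S f ≡ lookup S p xor lookup S q) →
  ∀ {c} → KmaxPlus X c × KmaxPlus Y c → c f ≡ 0ℚ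
nested-vanishing {n} {X} {Y} X⊆Y {p} {q} p≢q Xp Yp Xq Yq {f} f-crosses {c} ((c≥0 , X-max) , (_ , Y-max)) =
  ≤-antisym c-f≤0 (c≥0 f)
  where
  X⁺ Y⁻ : Subset n
  X⁺ = X [ p ]≔ true
  Y⁻ = Y [ p ]≔ false
  X⁺p : lookup X⁺ p ≡ true
  X⁺p = lookup∘update p X true
  Y⁻p : lookup Y⁻ p ≡ false
  Y⁻p = lookup∘update p Y false
  X⁺q : lookup X⁺ q ≡ false
  X⁺q = trans (lookup∘update′ (p≢q ∘ sym) X true) Xq
  Y⁻q : lookup Y⁻ q ≡ true
  Y⁻q = trans (lookup∘update′ (p≢q ∘ sym) Y false) Yq
  -- The second vertex `q` keeps `X⁺` proper and `Y⁻` nonempty, so both are legitimate competitors.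
  X⁺-cut : IsCut X⁺
  X⁺-cut = (p , lookup⇒[]= p X⁺ X⁺p) , ∈-∁⁺ {X = X⁺} X⁺q
  Y⁻-cut : IsCut Y⁻
  Y⁻-cut = (q , lookup⇒[]= q Y⁻ Y⁻q) , ∈-∁⁺ {X = Y⁻} Y⁻p
  pattern-at : ∀ i → Pattern (lookup X i) (lookup Y i) (lookup X⁺ i) (lookup Y⁻ i)
  pattern-at i with i Fin.≟ p
  ... | yes refl rewrite Xp | Yp | X⁺p | Y⁻p = pivot
  ... | no  i≢p  rewrite lookup∘update′ i≢p X true | lookup∘update′ i≢p Y false
    with lookup X i | lookup Y i | X⊆Y i
  ... | true  | true  | _   = inner
  ... | true  | false | x⇒y = contradiction (x⇒y refl) λ ()
  ... | false | true  | _   = middle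
  ... | false | false | _   = outer
  surplus : Vector n
  surplus e = cutVec X⁺ e + cutVec Y⁻ e - (cutVec X e + cutVec Y e)
  surplus≥0 : ∀ e → 0ℚ ≤ surplus e
  surplus≥0 (edge i j _) = uncross (pattern-at i) (pattern-at j)
  surplus-f : surplus f ≡ 2ℚ
  surplus-f rewrite f-crosses X | f-crosses Y | f-crosses X⁺ | f-crosses Y⁻ | Xp | Yp | Xq | Yq | X⁺p | Y⁻p | X⁺q | Y⁻q = refl
  total : ⟨ c , surplus ⟩ ≡ ⟨ c , cutVec X⁺ ⟩ + ⟨ c , cutVec Y⁻ ⟩ - (⟨ c , cutVec X ⟩ + ⟨ c , cutVec Y ⟩)
  total = begin
    ⟨ c , surplus ⟩
      ≡⟨ ∑-cong (edges n) (λ e → solve 5 (λ c x⁺ y⁻ x y → c :* (x⁺ :+ y⁻ :- (x :+ y)) := c :* x⁺ :+ c :* y⁻ :- (c :* x :+ c :* y)) refl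
           (c e) (cutVec X⁺ e) (cutVec Y⁻ e) (cutVec X e) (cutVec Y e)) ⟩
    ∑ (edges n) (λ e → c e * cutVec X⁺ e + c e * cutVec Y⁻ e - (c e * cutVec X e + c e * cutVec Y e))
      ≡⟨ ∑-distrib-minus (edges n) _ _ ⟩
    ∑ (edges n) (λ e → c e * cutVec X⁺ e + c e * cutVec Y⁻ e) - ∑ (edges n) (λ e → c e * cutVec X e + c e * cutVec Y e)
      ≡⟨ cong₂ _-_ (∑-distrib-+ (edges n) _ _) (∑-distrib-+ (edges n) _ _) ⟩
    ⟨ c , cutVec X⁺ ⟩ + ⟨ c , cutVec Y⁻ ⟩ - (⟨ c , cutVec X ⟩ + ⟨ c , cutVec Y ⟩) ∎
    where open ≡-Reasoning
  -- The total surplus is at least twice `c f`, and maximality of `X` and of `Y` makes it at most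
  -- zero.
  c-f≤0 : c f ≤ 0ℚ
  c-f≤0 = begin
    c f                    ≡⟨ +-identityʳ (c f) ⟨
    c f + 0ℚ               ≤⟨ +-monoʳ-≤ (c f) (c≥0 f) ⟩
    c f + c f              ≡⟨ cong₂ _+_ (*-identityʳ (c f)) (*-identityʳ (c f)) ⟨
    c f * 1ℚ + c f * 1ℚ    ≡⟨ *-distribˡ-+ (c f) 1ℚ 1ℚ ⟨
    c f * 2ℚ               ≡⟨ cong (c f *_) surplus-f ⟨
    c f * surplus f        ≤⟨ term≤∑ (λ e → *-nonNeg (c≥0 e) (surplus≥0 e)) (∈-edges f) ⟩
    ⟨ c , surplus ⟩        ≡⟨ total ⟩
    ⟨ c , cutVec X⁺ ⟩ + ⟨ c , cutVec Y⁻ ⟩ - M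
                           ≤⟨ +-monoˡ-≤ (- M) (+-mono-≤ (X-max X⁺ X⁺-cut) (Y-max Y⁻ Y⁻-cut)) ⟩
    M - M                  ≡⟨ +-inverseʳ M ⟩
    0ℚ                     ∎
    where
    open ≤-Reasoning
    M = ⟨ c , cutVec X ⟩ + ⟨ c , cutVec Y ⟩

nested-nonadjacent : ∀ {n} {X Y : Subset n} → IsCut X → IsCut Y → (∀ i → lookup X i ≡ true → lookup Y i ≡ true) →
  ∀ {p q} → p ≢ q → lookup X p ≡ false → lookup Y p ≡ true → lookup X q ≡ false → lookup Y q ≡ true → ¬ Adjacent X Y
nested-nonadjacent {X = X} {Y} X-cut@((a , a∈X) , _) Y-cut X⊆Y {p} {q} p≢q Xp Yp Xq Yq
  with f , f-crosses ← edgeBetween p≢q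
  -- An edge from a vertex of `X` to `p` is cut by `X` but lies inside `Y`; it tells the two cuts
  -- apart.
  with e₀ , e₀-crosses ← edgeBetween {p = a} {p} (λ a≡p → Bool.not-¬ Xp (trans (sym (cong (lookup X) a≡p)) ([]=⇒lookup a∈X))) =
  extra-equation X-cut Y-cut {e₀} e₀-differs {f} f-agrees
    (λ {c} → nested-vanishing {X = X} {Y} X⊆Y p≢q Xp Yp Xq Yq f-crosses {c})
  where
  Xa : lookup X a ≡ true
  Xa = []=⇒lookup a∈X
  e₀-differs : crosses X e₀ ≢ crosses Y e₀
  e₀-differs rewrite e₀-crosses X | e₀-crosses Y | Xa | X⊆Y a Xa | Xp | Yp = λ ()
  f-agrees : crosses X f ≡ crosses Y f
  f-agrees rewrite f-crosses X | f-crosses Y | Xp | Yp | Xq | Yq = refl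

-- Symmetric differences and sets of cardinality one.

lookup-─ : ∀ {n} (X Y : Subset n) i → lookup (X ─ Y) i ≡ lookup X i ∧ not (lookup Y i)
lookup-─ (true  ∷ X) (true  ∷ Y) zero = refl
lookup-─ (true  ∷ X) (false ∷ Y) zero = refl
lookup-─ (false ∷ X) (true  ∷ Y) zero = refl
lookup-─ (false ∷ X) (false ∷ Y) zero = refl
lookup-─ (_ ∷ X) (_ ∷ Y) (suc i) = lookup-─ X Y i

lookup-⊖ : ∀ {n} (X Y : Subset n) i → lookup (X ⊖ Y) i ≡ lookup X i xor lookup Y i
lookup-⊖ X Y i rewrite lookup-zipWith _∨_ i (X ─ Y) (Y ─ X) | lookup-─ X Y i | lookup-─ Y X i =
  table (lookup X i) (lookup Y i)
  where
  table : ∀ x y → x ∧ not y ∨ y ∧ not x ≡ x xor y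
  table true  true  = refl
  table true  false = refl
  table false true  = refl
  table false false = refl

∣S∣≡0⇒∉ : ∀ {n} (S : Subset n) → ∣ S ∣ ≡ 0 → ∀ i → lookup S i ≡ false
∣S∣≡0⇒∉ (false ∷ S) |S|≡0 zero    = refl
∣S∣≡0⇒∉ (false ∷ S) |S|≡0 (suc i) = ∣S∣≡0⇒∉ S |S|≡0 i

∉⇒∣S∣≡0 : ∀ {n} (S : Subset n) → (∀ i → lookup S i ≢ true) → ∣ S ∣ ≡ 0
∉⇒∣S∣≡0 []          none = refl
∉⇒∣S∣≡0 (true  ∷ S) none = contradiction refl (none zero)
∉⇒∣S∣≡0 (false ∷ S) none = ∉⇒∣S∣≡0 S (none ∘ suc)

∣S∣≡1⇒unique : ∀ {n} (S : Subset n) → ∣ S ∣ ≡ 1 → ∃ λ p → lookup S p ≡ true × (∀ i → lookup S i ≡ true → i ≡ p)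
∣S∣≡1⇒unique (true  ∷ S) |S|≡1 = zero , refl , λ
  { zero    _  → refl
  ; (suc i) Si → contradiction (trans (sym Si) (∣S∣≡0⇒∉ S (ℕ.suc-injective |S|≡1) i)) λ () }
∣S∣≡1⇒unique (false ∷ S) |S|≡1 with p , Sp , unique ← ∣S∣≡1⇒unique S |S|≡1 =
  suc p , Sp , λ { (suc i) Si → cong suc (unique i Si) }

∣S∣≡1⊎two : ∀ {n} (S : Subset n) {i} → lookup S i ≡ true →
  ∣ S ∣ ≡ 1 ⊎ ∃₂ λ p q → p ≢ q × lookup S p ≡ true × lookup S q ≡ true
∣S∣≡1⊎two (true ∷ S) _ with Fin.any? (λ q → lookup S q Bool.≟ true)
... | yes (q , Sq) = inj₂ (zero , suc q , (λ ()) , refl , Sq)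
... | no  none     = inj₁ (cong suc (∉⇒∣S∣≡0 S (λ q Sq → none (q , Sq))))
∣S∣≡1⊎two (false ∷ S) {suc i} Si with ∣S∣≡1⊎two S Si
... | inj₁ |S|≡1                   = inj₁ |S|≡1
... | inj₂ (p , q , p≢q , Sp , Sq) = inj₂ (suc p , suc q , p≢q ∘ Fin.suc-injective , Sp , Sq)

⊆-xor : ∀ {x y} → (x ≡ true → y ≡ true) → x xor y ≡ true → x ≡ false × y ≡ true
⊆-xor {true}  {false} x⇒y _ = contradiction (x⇒y refl) λ ()
⊆-xor {false} {true}  x⇒y _ = refl , refl

xor-≢ : ∀ {x y} → x ≢ y → x xor y ≡ true
xor-≢ {true}  {true}  x≢y = contradiction refl x≢y
xor-≢ {true}  {false} x≢y = refl
xor-≢ {false} {true}  x≢y = refl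
xor-≢ {false} {false} x≢y = contradiction refl x≢y

lookup-ext : ∀ {n} {X Y : Subset n} → (∀ i → lookup X i ≡ lookup Y i) → X ≡ Y
lookup-ext {X = []}    {[]}    X≗Y = refl
lookup-ext {X = x ∷ X} {y ∷ Y} X≗Y = cong₂ _∷_ (X≗Y zero) (lookup-ext (X≗Y ∘ suc))

-- The sets differ somewhere; two distinct vertices of `X ⊖ Y` would both lie in `Y ─ X` by nesting
-- and contradict adjacency.
nested-adjacent⇒∣⊖∣≡1 : ∀ {n} {X Y : Subset n} → IsCut X → IsCut Y → X ≢ Y →
  (∀ i → lookup X i ≡ true → lookup Y i ≡ true) → Adjacent X Y → ∣ X ⊖ Y ∣ ≡ 1
nested-adjacent⇒∣⊖∣≡1 {X = X} {Y} X-cut Y-cut X≢Y X⊆Y adj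
  with Fin.any? (λ i → ¬? (lookup X i Bool.≟ lookup Y i))
... | no  none         = contradiction (lookup-ext (λ i → decidable-stable (lookup X i Bool.≟ lookup Y i) (λ ne → none (i , ne)))) X≢Y
... | yes (i , differ) with ∣S∣≡1⊎two (X ⊖ Y) (trans (lookup-⊖ X Y i) (xor-≢ differ))
... | inj₁ |X⊖Y|≡1                 = |X⊖Y|≡1
... | inj₂ (p , q , p≢q , Tp , Tq) =
  let Xp , Yp = ⊆-xor (X⊆Y p) (trans (sym (lookup-⊖ X Y p)) Tp)
      Xq , Yq = ⊆-xor (X⊆Y q) (trans (sym (lookup-⊖ X Y q)) Tq)
  in contradiction adj (nested-nonadjacent X-cut Y-cut X⊆Y p≢q Xp Yp Xq Yq)

-- The four cells determined by two sets, and the case analysis for necessity.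

∈⇒lookup-∩ : ∀ {n} {X Y : Subset n} → Nonempty (X ∩ Y) → ∃ λ i → lookup X i ≡ true × lookup Y i ≡ true
∈⇒lookup-∩ {X = X} {Y} (i , i∈) with lookup X i in Xi | lookup Y i in Yi | trans (sym (lookup-zipWith _∧_ i X Y)) ([]=⇒lookup i∈)
... | true | true | _ = i , Xi , Yi

∈⇒lookup-─ : ∀ {n} {X Y : Subset n} → Nonempty (X ─ Y) → ∃ λ i → lookup X i ≡ true × lookup Y i ≡ false
∈⇒lookup-─ {X = X} {Y} (i , i∈) with lookup X i in Xi | lookup Y i in Yi | trans (sym (lookup-─ X Y i)) ([]=⇒lookup i∈)
... | true | false | _ = i , Xi , Yi

∈⇒lookup-∁∪ : ∀ {n} {X Y : Subset n} → Nonempty (∁ (X ∪ Y)) → ∃ λ i → lookup X i ≡ false × lookup Y i ≡ false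
∈⇒lookup-∁∪ {X = X} {Y} nonempty with i , i∉ ← ∈-∁⁻ {X = X ∪ Y} nonempty
  with lookup X i in Xi | lookup Y i in Yi | trans (sym (lookup-zipWith _∨_ i X Y)) i∉
... | false | false | _ = i , Xi , Yi

cell? : ∀ {n} (X Y : Subset n) x y → Dec (∃ λ i → lookup X i ≡ x × lookup Y i ≡ y)
cell? X Y x y = Fin.any? (λ i → lookup X i Bool.≟ x ×-dec lookup Y i Bool.≟ y)

crossing : ∀ {n} {X Y : Subset n} →
  (∃ λ i → lookup X i ≡ true × lookup Y i ≡ true) → (∃ λ i → lookup X i ≡ true × lookup Y i ≡ false) →
  (∃ λ i → lookup X i ≡ false × lookup Y i ≡ true) → (∃ λ i → lookup X i ≡ false × lookup Y i ≡ false) → Crossing X Y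
crossing {X = X} {Y} (a , Xa , Ya) (b , Xb , Yb) (c , Xc , Yc) (d , Xd , Yd) =
  (a , lookup⇒[]= a (X ∩ Y) (trans (lookup-zipWith _∧_ a X Y) (cong₂ _∧_ Xa Ya))) ,
  (b , lookup⇒[]= b (X ─ Y) (trans (lookup-─ X Y b) (cong₂ (λ x y → x ∧ not y) Xb Yb))) ,
  (c , lookup⇒[]= c (Y ─ X) (trans (lookup-─ Y X c) (cong₂ (λ y x → y ∧ not x) Yc Xc))) ,
  ∈-∁⁺ {X = X ∪ Y} {d} (trans (lookup-zipWith _∨_ d X Y) (cong₂ _∨_ Xd Yd))

∁-involutive : ∀ {n} (X : Subset n) → ∁ (∁ X) ≡ X
∁-involutive X = lookup-ext λ i →
  trans (lookup-∁ (∁ X) i) (trans (cong not (lookup-∁ X i)) (Bool.not-involutive (lookup X i)))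

IsCut-∁ : ∀ {n} {X : Subset n} → IsCut X → IsCut (∁ X)
IsCut-∁ {X = X} (nonempty , proper) = proper , subst Nonempty (sym (∁-involutive X)) nonempty

-- Crossing means that all four cells are inhabited. Any empty cell is an inclusion between `X` or
-- its complement and `Y` or its complement, and complementing preserves cut vectors, so the nested
-- case applies.
adjacent⇒ : ∀ {n} {X Y : Subset n} → IsCut X → IsCut Y → DistinctCuts X Y → Adjacent X Y →
  Crossing X Y ⊎ (∣ X ⊖ Y ∣ ≡ 1 ⊎ ∣ ∁ X ⊖ Y ∣ ≡ 1 ⊎ ∣ X ⊖ ∁ Y ∣ ≡ 1 ⊎ ∣ ∁ X ⊖ ∁ Y ∣ ≡ 1)
adjacent⇒ {n} {X} {Y} X-cut Y-cut (X≢Y , X≢∁Y) adj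
  with cell? X Y true true | cell? X Y true false | cell? X Y false true | cell? X Y false false
... | yes a | yes b | yes c | yes d = inj₁ (crossing {X = X} {Y} a b c d)
... | _ | no no-b | _ | _ = inj₂ (inj₁ (nested-adjacent⇒∣⊖∣≡1 X-cut Y-cut X≢Y X⊆Y adj))
  where
  X⊆Y : ∀ i → lookup X i ≡ true → lookup Y i ≡ true
  X⊆Y i Xi = Bool.¬-not (λ Yi → no-b (i , Xi , Yi))
... | _ | _ | no no-c | _ = inj₂ (inj₁ (trans (cong ∣_∣ (∪-comm (X ─ Y) (Y ─ X)))
    (nested-adjacent⇒∣⊖∣≡1 Y-cut X-cut (X≢Y ∘ sym) Y⊆X (Adjacent-sym {X = X} {Y} adj))))
  where
  Y⊆X : ∀ i → lookup Y i ≡ true → lookup X i ≡ true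
  Y⊆X i Yi = Bool.¬-not (λ Xi → no-c (i , Xi , Yi))
... | no no-a | _ | _ | _ = inj₂ (inj₂ (inj₂ (inj₁ (nested-adjacent⇒∣⊖∣≡1 X-cut (IsCut-∁ Y-cut) X≢∁Y X⊆∁Y
    (Adjacent-resp {X = X} {X} {Y} {∁ Y} (λ _ → refl) (crosses-∁ Y) adj)))))
  where
  X⊆∁Y : ∀ i → lookup X i ≡ true → lookup (∁ Y) i ≡ true
  X⊆∁Y i Xi = trans (lookup-∁ Y i) (cong not (Bool.¬-not (λ Yi → no-a (i , Xi , Yi))))
... | _ | _ | _ | no no-d = inj₂ (inj₂ (inj₁ (nested-adjacent⇒∣⊖∣≡1 (IsCut-∁ X-cut) Y-cut
    (λ ∁X≡Y → X≢∁Y (trans (sym (∁-involutive X)) (cong ∁ ∁X≡Y))) ∁X⊆Y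
    (Adjacent-resp {X = X} {∁ X} {Y} {Y} (crosses-∁ X) (λ _ → refl) adj))))
  where
  ∁X⊆Y : ∀ i → lookup (∁ X) i ≡ true → lookup Y i ≡ true
  ∁X⊆Y i ∁Xi = Bool.¬-not (λ Yi → no-d (i , Bool.not-injective (trans (sym (lookup-∁ X i)) ∁Xi) , Yi))

-- Rigidity of the strong edges, and the sufficient conditions.

xor-shift : ∀ z u {s} → z xor u ≡ s → z ≡ s xor u
xor-shift true  true  refl = refl
xor-shift true  false refl = refl
xor-shift false true  refl = refl
xor-shift false false refl = refl

-- `s xor lookup S i` is membership in `S` or in its complement, depending on `s`; both give the
-- same cut.
crosses-flip : ∀ {n} {Z S : Subset n} s → (∀ i → lookup Z i ≡ s xor lookup S i) → ∀ e → crosses Z e ≡ crosses S e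
crosses-flip         false Z≡ (edge i j _) = cong₂ _xor_ (Z≡ i) (Z≡ j)
crosses-flip {S = S} true  Z≡ (edge i j _) = trans (cong₂ _xor_ (Z≡ i) (Z≡ j)) (not-xor-not (lookup S i) (lookup S j))

-- Z meets the two classes X ⊖ Y and its complement in X up to a flip on each class;
-- equal flips give the cut X, opposite ones the cut Y.
module Rigidity {n : ℕ} {X Y : Subset n} (Z : Subset n)
  (Z-cuts : ∀ e → crosses X e ≡ true → crosses Y e ≡ true → crosses Z e ≡ true) where

  -- Within one class, vertices separated by `X` are also separated by `Y`, so the edge joining them
  -- is strong and `Z` has to cut it.
  Z-separates : ∀ {i j} → lookup X i ≡ true → lookup X j ≡ false → lookup X i xor lookup Y i ≡ lookup X j xor lookup Y j →
                lookup Z i ≡ not (lookup Z j)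
  Z-separates {i} {j} Xi Xj same
    with e , e-crosses ← edgeBetween {p = i} {j} (λ i≡j → contradiction (trans (sym Xi) (trans (cong (lookup X) i≡j) Xj)) λ ()) =
    table (lookup X i) (lookup X j) (lookup Y i) (lookup Y j) (lookup Z i) (lookup Z j) Xi Xj same
      (λ x y → trans (sym (e-crosses Z)) (Z-cuts e (trans (e-crosses X) x) (trans (e-crosses Y) y)))
    where
    table : ∀ x x′ y y′ z z′ → x ≡ true → x′ ≡ false → x xor y ≡ x′ xor y′ →
            (x xor x′ ≡ true → y xor y′ ≡ true → z xor z′ ≡ true) → z ≡ not z′
    table true false true  false true  z′    _ _ _ cuts = sym (cuts refl refl)
    table true false false true  true  z′    _ _ _ cuts = sym (cuts refl refl)
    table true false true  false false true  _ _ _ cuts = refl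
    table true false true  false false false _ _ _ cuts = cuts refl refl
    table true false false true  false true  _ _ _ cuts = refl
    table true false false true  false false _ _ _ cuts = cuts refl refl

  -- The class has reference vertices `i₀` and `j₀` on the two sides of `X`. A vertex in `X` is
  -- compared through `j₀`, any other directly with `i₀`; the common value is the flip at `i₀`,
  -- where `X` holds `true`.
  flip-constant : ∀ {i₀ j₀} → lookup X i₀ ≡ true → lookup X j₀ ≡ false →
    lookup X i₀ xor lookup Y i₀ ≡ lookup X j₀ xor lookup Y j₀ →
    ∀ i → lookup X i xor lookup Y i ≡ lookup X i₀ xor lookup Y i₀ → lookup Z i xor lookup X i ≡ not (lookup Z i₀)
  flip-constant {i₀} {j₀} Xi₀ Xj₀ same i same-i with lookup X i in Xi
  ... | true  = trans (Bool.xor-comm (lookup Z i) true) (cong not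
                  (trans (Z-separates Xi Xj₀ (trans (cong (_xor lookup Y i) Xi) (trans same-i same))) (sym (Z-separates Xi₀ Xj₀ same))))
  ... | false = trans (Bool.xor-comm (lookup Z i) false) (trans (sym (Bool.not-involutive (lookup Z i)))
                  (cong not (sym (Z-separates Xi₀ Xi (trans (sym same-i) (cong (_xor lookup Y i) (sym Xi)))))))

  rigid : ∀ {s t} → (∀ i → lookup X i xor lookup Y i ≡ false → lookup Z i xor lookup X i ≡ s) →
                    (∀ i → lookup X i xor lookup Y i ≡ true  → lookup Z i xor lookup X i ≡ t) →
          (∀ e → crosses Z e ≡ crosses X e) ⊎ (∀ e → crosses Z e ≡ crosses Y e)
  rigid {s} {t} on-∁T on-T with s Bool.≟ t
  ... | yes refl = inj₁ (crosses-flip {Z = Z} {X} s Z≡)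
    where
    Z≡ : ∀ i → lookup Z i ≡ s xor lookup X i
    Z≡ i with lookup X i xor lookup Y i in T
    ... | true  = xor-shift (lookup Z i) (lookup X i) (on-T i T)
    ... | false = xor-shift (lookup Z i) (lookup X i) (on-∁T i T)
  ... | no s≢t = inj₂ (crosses-flip {Z = Z} {Y} s Z≡)
    where
    in-T : ∀ s x y → x xor y ≡ true → not s xor x ≡ s xor y
    in-T true  true  false _ = refl
    in-T true  false true  _ = refl
    in-T false true  false _ = refl
    in-T false false true  _ = refl
    in-∁T : ∀ s x y → x xor y ≡ false → s xor x ≡ s xor y
    in-∁T s true  true  _ = refl
    in-∁T s false false _ = refl
    Z≡ : ∀ i → lookup Z i ≡ s xor lookup Y i
    Z≡ i with lookup X i xor lookup Y i in T
    -- On `X ⊖ Y` membership in `Y` negates membership in `X`, so flipping `X` by `not s` amounts to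
    -- flipping `Y` by `s`.
    ... | true  = trans (xor-shift (lookup Z i) (lookup X i) (trans (on-T i T) (Bool.¬-not (s≢t ∘ sym)))) (in-T s (lookup X i) (lookup Y i) T)
    ... | false = trans (xor-shift (lookup Z i) (lookup X i) (on-∁T i T)) (in-∁T s (lookup X i) (lookup Y i) T)

-- e⁺ and e⁻ join a vertex of X ⊖ Y to one of X ∩ Y and one outside X ∪ Y.
adjacent-if-rigid : ∀ {n} {X Y : Subset n} → IsCut X → IsCut Y →
  (∃ λ a → lookup X a ≡ true × lookup Y a ≡ true) → (∃ λ d → lookup X d ≡ false × lookup Y d ≡ false) →
  (∃ λ p → lookup X p xor lookup Y p ≡ true) →
  (∀ Z → (∀ e → crosses X e ≡ true → crosses Y e ≡ true → crosses Z e ≡ true) →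
     ∃ λ t → ∀ i → lookup X i xor lookup Y i ≡ true → lookup Z i xor lookup X i ≡ t) →
  Adjacent X Y
adjacent-if-rigid {n} {X} {Y} X-cut Y-cut (a , Xa , Ya) (d , Xd , Yd) (p , Tp) T-rigid =
  conclude (lookup X p) (lookup Y p) refl refl Tp
  where
  rigid-XY : ∀ Z → (∀ e → crosses X e ≡ true → crosses Y e ≡ true → crosses Z e ≡ true) →
    (∀ e → crosses Z e ≡ crosses X e) ⊎ (∀ e → crosses Z e ≡ crosses Y e)
  -- Outside `X ⊖ Y` the vertices `a` and `d` are the references on the two sides of `X`; on `X ⊖ Y`
  -- a constant flip is the hypothesis `T-rigid`.
  rigid-XY Z Z-cuts = rigid {s = not (lookup Z a)}
    (λ i ∁Ti → flip-constant Xa Xd (trans (cong₂ _xor_ Xa Ya) (sym (cong₂ _xor_ Xd Yd))) i (trans ∁Ti (sym (cong₂ _xor_ Xa Ya))))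
    (proj₂ (T-rigid Z Z-cuts))
    where open Rigidity {X = X} {Y} Z Z-cuts
  join : ∀ {i j} → lookup X i xor lookup Y i ≢ lookup X j xor lookup Y j → Σ (Edge n) λ e → ∀ S → crosses S e ≡ lookup S i xor lookup S j
  join differ = edgeBetween (λ i≡j → differ (cong (λ i → lookup X i xor lookup Y i) i≡j))
  p≁ : ∀ {i} → lookup X i xor lookup Y i ≡ false → lookup X i xor lookup Y i ≢ lookup X p xor lookup Y p
  p≁ i∉T same = contradiction (trans (sym i∉T) (trans same Tp)) λ ()
  conclude : ∀ x y → lookup X p ≡ x → lookup Y p ≡ y → x xor y ≡ true → Adjacent X Y
  conclude true false Xp Yp _ with e⁺ , at⁺ ← join (p≁ (cong₂ _xor_ Xd Yd)) | e⁻ , at⁻ ← join (p≁ (cong₂ _xor_ Xa Ya)) =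
    Adjacency.adjacent X Y X-cut Y-cut e⁺ e⁻
      (trans (at⁺ X) (cong₂ _xor_ Xd Xp)) (trans (at⁺ Y) (cong₂ _xor_ Yd Yp))
      (trans (at⁻ X) (cong₂ _xor_ Xa Xp)) (trans (at⁻ Y) (cong₂ _xor_ Ya Yp)) rigid-XY
  -- With `p` in `Y` alone, the edges to `a` and `d` exchange roles.
  conclude false true Xp Yp _ with e⁺ , at⁺ ← join (p≁ (cong₂ _xor_ Xa Ya)) | e⁻ , at⁻ ← join (p≁ (cong₂ _xor_ Xd Yd)) =
    Adjacency.adjacent X Y X-cut Y-cut e⁺ e⁻
      (trans (at⁺ X) (cong₂ _xor_ Xa Xp)) (trans (at⁺ Y) (cong₂ _xor_ Ya Yp))
      (trans (at⁻ X) (cong₂ _xor_ Xd Xp)) (trans (at⁻ Y) (cong₂ _xor_ Yd Yp)) rigid-XY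

-- The class `X ⊖ Y` also meets both sides of `X`, in `b` and `c`, so its flip is constant for the
-- same reason as outside it.
crossing⇒adjacent : ∀ {n} {X Y : Subset n} → IsCut X → IsCut Y → Crossing X Y → Adjacent X Y
crossing⇒adjacent {X = X} {Y} X-cut Y-cut (A , B , C , D)
  with b , Xb , Yb ← ∈⇒lookup-─ {X = X} {Y} B | c , Yc , Xc ← ∈⇒lookup-─ {X = Y} {X} C =
  adjacent-if-rigid X-cut Y-cut (∈⇒lookup-∩ {X = X} {Y} A) (∈⇒lookup-∁∪ {X = X} {Y} D) (b , cong₂ _xor_ Xb Yb)
    λ Z Z-cuts → not (lookup Z b) , λ i Ti → Rigidity.flip-constant {X = X} {Y} Z Z-cuts Xb Xc
      (trans (cong₂ _xor_ Xb Yb) (sym (cong₂ _xor_ Xc Yc))) i (trans Ti (sym (cong₂ _xor_ Xb Yb)))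

-- On a single vertex the flip is trivially constant. The helper `common`, used with both truth
-- values, finds a vertex in both sets and one in neither, since both sets are cuts.
∣⊖∣≡1⇒adjacent : ∀ {n} {X Y : Subset n} → IsCut X → IsCut Y → ∣ X ⊖ Y ∣ ≡ 1 → Adjacent X Y
∣⊖∣≡1⇒adjacent {X = X} {Y} X-cut@((i , i∈X) , X-proper) Y-cut@((j , j∈Y) , Y-proper) |X⊖Y|≡1
  with p , p∈ , unique ← ∣S∣≡1⇒unique (X ⊖ Y) |X⊖Y|≡1 =
  adjacent-if-rigid X-cut Y-cut (common true (i , []=⇒lookup i∈X) (j , []=⇒lookup j∈Y))
    (common false (∈-∁⁻ {X = X} X-proper) (∈-∁⁻ {X = Y} Y-proper)) (p , trans (sym (lookup-⊖ X Y p)) p∈)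
    λ Z _ → lookup Z p xor lookup X p , λ i Ti → cong (λ i → lookup Z i xor lookup X i) (only-p i Ti)
  where
  only-p : ∀ i → lookup X i xor lookup Y i ≡ true → i ≡ p
  only-p i Ti = unique i (trans (lookup-⊖ X Y i) Ti)
  common : ∀ b → (∃ λ i → lookup X i ≡ b) → (∃ λ j → lookup Y j ≡ b) → ∃ λ a → lookup X a ≡ b × lookup Y a ≡ b
  common b (i , Xi) (j , Yj) with lookup Y i Bool.≟ b | lookup X j Bool.≟ b
  ... | yes Yi | _      = i , Xi , Yi
  ... | no  _  | yes Xj = j , Xj , Yj
  -- Here `i` and `j` both belong to `X ⊖ Y`, hence coincide.
  ... | no ¬Yi | no ¬Xj = i , Xi , trans (cong (lookup Y) i≡j) Yj
    where
    i≡j : i ≡ j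
    i≡j = trans (only-p i (xor-≢ (λ eq → ¬Yi (trans (sym eq) Xi)))) (sym (only-p j (xor-≢ (λ eq → ¬Xj (trans eq Yj)))))

theorem3 : (n : ℕ) → 2 ℕ.≤ n → (X Y : Subset n) → IsCut X → IsCut Y → DistinctCuts X Y →
    Adjacent X Y ⇔ (Crossing X Y ⊎ (∣ X ⊖ Y ∣ ≡ 1 ⊎ ∣ ∁ X ⊖ Y ∣ ≡ 1 ⊎ ∣ X ⊖ ∁ Y ∣ ≡ 1 ⊎ ∣ ∁ X ⊖ ∁ Y ∣ ≡ 1))
theorem3 n 2≤n X Y X-cut Y-cut distinct = mk⇔ (adjacent⇒ X-cut Y-cut distinct) λ
  { (inj₁ cross)                     → crossing⇒adjacent X-cut Y-cut cross
  ; (inj₂ (inj₁ one))                → ∣⊖∣≡1⇒adjacent X-cut Y-cut one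
  -- The remaining alternatives are the previous one for other representatives of the same two cuts.
  ; (inj₂ (inj₂ (inj₁ one)))         → restore (∁ X) Y (sym ∘ crosses-∁ X) (λ _ → refl) (∣⊖∣≡1⇒adjacent (IsCut-∁ X-cut) Y-cut one)
  ; (inj₂ (inj₂ (inj₂ (inj₁ one)))) → restore X (∁ Y) (λ _ → refl) (sym ∘ crosses-∁ Y) (∣⊖∣≡1⇒adjacent X-cut (IsCut-∁ Y-cut) one)
  ; (inj₂ (inj₂ (inj₂ (inj₂ one)))) → restore (∁ X) (∁ Y) (sym ∘ crosses-∁ X) (sym ∘ crosses-∁ Y)
                                         (∣⊖∣≡1⇒adjacent (IsCut-∁ X-cut) (IsCut-∁ Y-cut) one) }
  where
  restore : ∀ X′ Y′ → (∀ e → crosses X′ e ≡ crosses X e) → (∀ e → crosses Y′ e ≡ crosses Y e) → Adjacent X′ Y′ → Adjacent X Y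
  restore X′ Y′ = Adjacent-resp {X = X′} {X} {Y′} {Y}
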